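{- Let $\dot{G}=(G,\sigma)$ be an unbalanced signed graph of order $n$, and let $k$ be an integer with $3 \le k \le n/10-1$. If $\dot{G}$ is $C_{2k+1}^{ - }$-free, then $$e(\dot{G}) \le \frac{n(n-1)}{2}-2(n-3),$$ with equality if and only if $\dot{G}$ is switching equivalent to $C_{3}^{ - } \cdot K_{n-2}$.
   Context: All graphs are finite, simple and undirected. A signed graph $\dot{G}=(G,\sigma)$ is a graph $G$ (the underlying graph) together with a sign function $\sigma:E(G)\to\{+1,-1\}$; $e(\dot{G})=|E(G)|$. The sign of a cycle is the product of the signs of its edges; a cycle is positive or negative accordingly, and $C_l^-$ denotes a negative cycle of length $l$. For $U\subseteq V(G)$, switching at $U$ reverses the sign of every edge between $U$ and $V(G)\setminus U$; two signed graphs are switching equivalent if one is obtained from the other by such a switching. A signed graph is balanced if it is switching equivalent to one with all edges positive (equivalently, every cycle is positive), and unbalanced otherwise. A signed graph is $C_{2k+1}^-$-free if it has no subgraph switching equivalent to $C_{2k+1}^-$ (i.e., it contains no negative cycle of length $2k+1$). $C_3^-\cdot K_{n-2}$ denotes the signed graph obtained from a negative triangle $C_3^-$ and an all-positive complete graph $(K_{n-2},+)$ by identifying one vertex of the triangle with one vertex of $K_{n-2}$. -}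

module Defs where

open import Data.Nat using (ℕ; zero; suc; _<_; _≤_; _+_)
open import Data.Nat.Properties using (_<?_)
open import Data.Fin using (Fin; zero; suc; toℕ; inject₁; fromℕ)
open import Data.Bool using (Bool; true; false; T; _∧_)
open import Data.List using (List; []; _∷_; foldr; map; concatMap; filterᵇ; length; allFin)
open import Data.Product using (Σ; _×_; _,_; ∃)
open import Relation.Nullary using (¬_)
open import Relation.Nullary.Decidable using (⌊_⌋)
open import Relation.Binary.PropositionalEquality using (_≡_; _≢_)
open import Function.Bundles using (_↔_; Inverse)

data Sign : Set where
  pos neg : Sign

_·_ : Sign → Sign → Sign
pos · s = s
neg · pos = neg
neg · neg = pos

-- A signed graph on vertex set Fin n: a simple undirected graph with
-- a sign on each edge (the sign function is only consulted on edges).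
record SignedGraph (n : ℕ) : Set where
  field
    adj     : Fin n → Fin n → Bool
    σ       : Fin n → Fin n → Sign
    adj-sym : ∀ i j → adj i j ≡ adj j i
    σ-sym   : ∀ i j → T (adj i j) → σ i j ≡ σ j i
    loopless : ∀ i → adj i i ≡ false
open SignedGraph public

allPairs : (n : ℕ) → List (Fin n × Fin n)
allPairs n = concatMap (λ i → map (λ j → (i , j)) (allFin n)) (allFin n)

e : ∀ {n} → SignedGraph n → ℕ
e {n} G = length (filterᵇ (λ { (i , j) → ⌊ toℕ i <? toℕ j ⌋ ∧ adj G i j }) (allPairs n))

record Cycle {n : ℕ} (G : SignedGraph n) (m : ℕ) : Set where
  field
    c        : Fin (suc m) → Fin n
    length≥3 : 3 ≤ suc m
    inj      : ∀ i j → c i ≡ c j → i ≡ j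
    step     : ∀ (i : Fin m) → T (adj G (c (inject₁ i)) (c (suc i)))
    close    : T (adj G (c (fromℕ m)) (c zero))
open Cycle public

cycleSign : ∀ {n m} {G : SignedGraph n} → Cycle G m → Sign
cycleSign {m = m} {G} C =
  foldr (λ i s → σ G (c C (inject₁ i)) (c C (suc i)) · s)
        (σ G (c C (fromℕ m)) (c C zero))
        (allFin m)

-- G contains a negative cycle of length l = suc m
HasNegCycle : ∀ {n} → SignedGraph n → ℕ → Set
HasNegCycle G m = Σ (Cycle G m) λ C → cycleSign C ≡ neg

-- C_{2k+1}^- -free: no negative cycle of length 2k+1
NegOddCycleFree : ∀ {n} → SignedGraph n → ℕ → Set
NegOddCycleFree G k = ¬ HasNegCycle G (k + k)

-- Balanced: switching equivalent to the all-positive signature,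
-- i.e. some switching function θ makes every edge positive.
Balanced : ∀ {n} → SignedGraph n → Set
Balanced {n} G = Σ (Fin n → Sign) λ θ →
  ∀ i j → T (adj G i j) → θ i · (σ G i j · θ j) ≡ pos

Unbalanced : ∀ {n} → SignedGraph n → Set
Unbalanced G = ¬ Balanced G

SwitchingEquivalent : ∀ {n} → SignedGraph n → SignedGraph n → Set
SwitchingEquivalent {n} G H =
  Σ (Fin n ↔ Fin n) λ π → Σ (Fin n → Sign) λ θ →
    let f = Inverse.to π in
    (∀ i j → adj G (f i) (f j) ≡ adj H i j) ×
    (∀ i j → T (adj H i j) → θ (f i) · (σ G (f i) (f j) · θ (f j)) ≡ σ H i j)

-- C_3^- · K_{n-2} on Fin n (n ≥ 3): triangle on vertices 0,1,2 with the
-- edge 01 negative, vertex 2 identified with a vertex of the all-positive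
-- complete graph on vertices 2,…,n-1.
private
  isBig : ∀ {n} → Fin n → Bool
  isBig zero = false
  isBig (suc zero) = false
  isBig (suc (suc _)) = true

  isTwo : ∀ {n} → Fin n → Bool
  isTwo (suc (suc zero)) = true
  isTwo _ = false

  isSmall : ∀ {n} → Fin n → Bool
  isSmall zero = true
  isSmall (suc zero) = true
  isSmall (suc (suc _)) = false

  neqᵇ : ∀ {n} → Fin n → Fin n → Bool
  neqᵇ zero zero = false
  neqᵇ (suc i) (suc j) = neqᵇ i j
  neqᵇ _ _ = true

  is01 : ∀ {n} → Fin n → Fin n → Bool
  is01 zero (suc zero) = true
  is01 (suc zero) zero = true
  is01 _ _ = false

  tAdj : ∀ {n} → Fin n → Fin n → Bool
  tAdj i j with isBig i | isBig j
  ... | true  | true  = neqᵇ i j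
  ... | false | false = neqᵇ i j
  ... | true  | false = isTwo i
  ... | false | true  = isTwo j

  tσ : ∀ {n} → Fin n → Fin n → Sign
  tσ i j with is01 i j
  ... | true  = neg
  ... | false = pos

  neqᵇ-sym : ∀ {n} (i j : Fin n) → neqᵇ i j ≡ neqᵇ j i
  neqᵇ-sym zero zero = _≡_.refl
  neqᵇ-sym zero (suc j) = _≡_.refl
  neqᵇ-sym (suc i) zero = _≡_.refl
  neqᵇ-sym (suc i) (suc j) = neqᵇ-sym i j

  neqᵇ-refl : ∀ {n} (i : Fin n) → neqᵇ i i ≡ false
  neqᵇ-refl zero = _≡_.refl
  neqᵇ-refl (suc i) = neqᵇ-refl i

  is01-sym : ∀ {n} (i j : Fin n) → is01 i j ≡ is01 j i
  is01-sym zero zero = _≡_.refl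
  is01-sym zero (suc zero) = _≡_.refl
  is01-sym zero (suc (suc j)) = _≡_.refl
  is01-sym (suc zero) zero = _≡_.refl
  is01-sym (suc (suc i)) zero = _≡_.refl
  is01-sym (suc i) (suc j) with i | j
  ... | zero | zero = _≡_.refl
  ... | zero | suc _ = _≡_.refl
  ... | suc _ | zero = _≡_.refl
  ... | suc _ | suc _ = _≡_.refl

  tAdj-sym : ∀ {n} (i j : Fin n) → tAdj i j ≡ tAdj j i
  tAdj-sym i j with isBig i | isBig j
  ... | true  | true  = neqᵇ-sym i j
  ... | false | false = neqᵇ-sym i j
  ... | true  | false = _≡_.refl
  ... | false | true  = _≡_.refl

  tAdj-refl : ∀ {n} (i : Fin n) → tAdj i i ≡ false
  tAdj-refl i with isBig i
  ... | true  = neqᵇ-refl i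
  ... | false = neqᵇ-refl i

  tσ-sym : ∀ {n} (i j : Fin n) → tσ i j ≡ tσ j i
  tσ-sym i j rewrite is01-sym i j = _≡_.refl

C3⁻·K : (n : ℕ) → SignedGraph n
C3⁻·K n = record
  { adj = tAdj ; σ = tσ
  ; adj-sym = tAdj-sym
  ; σ-sym = λ i j _ → tσ-sym i j
  ; loopless = tAdj-refl }

{-# OPTIONS --safe #-}

-- Suppose e(G) is at least the claimed bound. A greedy Turán argument then yields a clique
-- C on at least 2k + 2 vertices. Comparing (2k+1)-cycles inside C shows that C is balanced; switch so
-- that it is all positive. Let M₁ be the set of vertices with two neighbours in C, and M₂ the set of
-- those with two neighbours in M₁. Any two vertices of M₂ are joined by a path with 2k ≥ 6 vertices, so a
-- further switching makes all edges inside M₂ positive, and all edges from one outer vertex to M₂ too.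
-- Hence an unbalanced G has two vertices outside M₂. Each of them has at most one neighbour in M₁, and
-- counting missing edges shows that there are just two, that they are adjacent, and that the other n − 2
-- vertices form a clique. Unless both attach to the same vertex by a negative triangle, G is balanced.

module Submission where

open import Defs
open import Data.Bool using (Bool; true; false; T; _∧_; not)
open import Data.Bool.Properties using (T?)
open import Data.Empty using (⊥; ⊥-elim)
open import Data.Fin using (Fin; zero; suc; toℕ; inject₁; fromℕ)
open import Data.Fin.Permutation as Permutation using (transpose; _∘ₚ_)
import Data.Fin.Permutation.Components as Components
open import Data.Fin.Properties using (any?; toℕ-injective) renaming (_≟_ to _≟ᶠ_)
open import Data.List using (List; []; _∷_; _++_; foldr; map; concatMap; filter; filterᵇ; length; lookup; tabulate; take; allFin)
open import Data.List.Properties using (length-++; length-take; length-tabulate; foldr-map; map-tabulate; filter-complete)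
import Data.List.Membership.DecPropositional as DecMembership
open import Data.List.Membership.Propositional using (_∈_; _∉_)
open import Data.List.Membership.Propositional.Properties using (∈-∃++; ∈-filter⁺; ∈-filter⁻; ∈-allFin; ∈-++⁺ˡ; ∈-++⁺ʳ; ∈-++⁻; ∈-lookup)
open import Data.List.Relation.Binary.Subset.Propositional using (_⊆_)
open import Data.List.Relation.Unary.All as All using (All; []; _∷_)
import Data.List.Relation.Unary.All.Properties as All
open import Data.List.Relation.Unary.AllPairs as AllPairs using (AllPairs; []; _∷_)
open import Data.List.Relation.Unary.Any using (here; there)
open import Data.List.Relation.Unary.Unique.Propositional using (Unique)
import Data.List.Relation.Unary.Unique.Propositional.Properties as Unique
open import Data.Nat using (ℕ; zero; suc; _+_; _*_; _∸_; _≤_; z≤n; s≤s; _≤?_)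
open import Data.Nat.ListAction using (sum)
open import Data.Nat.Properties hiding (_≟_)
open import Data.Nat.Tactic.RingSolver using (solve-∀)
open import Data.Product using (∃; _×_; _,_; proj₁; proj₂)
open import Data.Sum using (_⊎_; inj₁; inj₂)
open import Data.Unit using (tt)
open import Function using (_∘_; id)
open import Function.Bundles using (_⇔_; _↔_; Inverse; mk⇔)
open import Relation.Binary.PropositionalEquality
open import Relation.Nullary using (¬_; Dec; yes; no; contradiction)
open import Relation.Nullary.Decidable using (_×-dec_; _→-dec_; ¬?; from-yes; ⌊_⌋; dec-true; dec-false)
open import Relation.Unary using (Decidable)

-- Signs

-- One device moves signs around. If a path with 2k vertices lies in an all-positive set and a
-- vertex off it sees both ends, the (2k+1)-cycle so closed is positive, hence the two closing edges
-- have equal signs. A vertex joins the set only with two neighbours in it, so that two adjacent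
-- newcomers can leave through distinct neighbours. Each enlargement may spend a vertex at either
-- end of a path, so paths with 2k vertices in M₂ rest on clique paths with as few as 2k - 4; such a
-- path has at least two vertices, which is where k ≥ 3 enters. Stopping at M₁ would not do: a
-- vertex outside M₁ is only known to miss all but one vertex of C, while the count needs outer
-- vertices missing all but one of M₁.
--
-- Missing edges are counted as ordered pairs with loops; at the claimed bound there are 5n - 12 of
-- them. The average non-degree is then just under 5, which is why Turán's argument uses (x - 5)² ≥
-- 0. It gives |C| ≥ n/5 ≥ 2k + 2: room for a path with 2k vertices and two clique vertices off it.

_≟ₛ_ : (s t : Sign) → Dec (s ≡ t)
pos ≟ₛ pos = yes refl
pos ≟ₛ neg = no λ ()
neg ≟ₛ pos = no λ ()
neg ≟ₛ neg = yes refl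

∀ₛ? : {P : Sign → Set} → (∀ s → Dec (P s)) → Dec (∀ s → P s)
∀ₛ? P? with P? pos | P? neg
... | yes p | yes q = yes λ { pos → p ; neg → q }
... | no ¬p | _     = no λ f → ¬p (f pos)
... | yes _ | no ¬q = no λ f → ¬q (f neg)

¬pos⇒neg : ∀ {s} → s ≢ pos → s ≡ neg
¬pos⇒neg {pos} s≢pos = contradiction refl s≢pos
¬pos⇒neg {neg} _     = refl

·-comm : ∀ s t → s · t ≡ t · s
·-comm = from-yes (∀ₛ? λ s → ∀ₛ? λ t → (s · t) ≟ₛ (t · s))

·-assoc : ∀ s t u → (s · t) · u ≡ s · (t · u)
·-assoc = from-yes (∀ₛ? λ s → ∀ₛ? λ t → ∀ₛ? λ u → ((s · t) · u) ≟ₛ (s · (t · u)))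

·-self : ∀ s → s · s ≡ pos
·-self = from-yes (∀ₛ? λ s → (s · s) ≟ₛ pos)

·≡pos⇒≡ : ∀ s t → s · t ≡ pos → s ≡ t
·≡pos⇒≡ = from-yes (∀ₛ? λ s → ∀ₛ? λ t → ((s · t) ≟ₛ pos) →-dec (s ≟ₛ t))

conj-sym : ∀ a s b → a · (s · b) ≡ b · (s · a)
conj-sym = from-yes (∀ₛ? λ a → ∀ₛ? λ s → ∀ₛ? λ b → (a · (s · b)) ≟ₛ (b · (s · a)))

conj-telescope : ∀ a s b t c → (a · (s · b)) · (b · (t · c)) ≡ a · ((s · t) · c)
conj-telescope = from-yes (∀ₛ? λ a → ∀ₛ? λ s → ∀ₛ? λ b → ∀ₛ? λ t → ∀ₛ? λ c →
  ((a · (s · b)) · (b · (t · c))) ≟ₛ (a · ((s · t) · c)))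

conj-loop : ∀ a s → a · (s · a) ≡ s
conj-loop = from-yes (∀ₛ? λ a → ∀ₛ? λ s → (a · (s · a)) ≟ₛ s)

-- Finite sums over lists

private variable
  A B : Set

∑ : List A → (A → ℕ) → ℕ
∑ xs f = sum (map f xs)

∑-mono : ∀ (xs : List A) {f g : A → ℕ} → (∀ {x} → x ∈ xs → f x ≤ g x) → ∑ xs f ≤ ∑ xs g
∑-mono []       f≤g = z≤n
∑-mono (x ∷ xs) f≤g = +-mono-≤ (f≤g (here refl)) (∑-mono xs (f≤g ∘ there))

∑-cong : ∀ (xs : List A) {f g : A → ℕ} → (∀ x → f x ≡ g x) → ∑ xs f ≡ ∑ xs g
∑-cong []       f≡g = refl
∑-cong (x ∷ xs) f≡g = cong₂ _+_ (f≡g x) (∑-cong xs f≡g)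

swap-front : ∀ a b c → a + (b + c) ≡ b + (a + c)
swap-front = solve-∀

+-interchange : ∀ a b c d → (a + b) + (c + d) ≡ (a + c) + (b + d)
+-interchange = solve-∀

∑-+ : ∀ (xs : List A) (f g : A → ℕ) → ∑ xs (λ x → f x + g x) ≡ ∑ xs f + ∑ xs g
∑-+ []       f g = refl
∑-+ (x ∷ xs) f g = trans (cong (f x + g x +_) (∑-+ xs f g)) (+-interchange (f x) (g x) _ _)

∑-const : ∀ (xs : List A) m → ∑ xs (λ _ → m) ≡ length xs * m
∑-const []       m = refl
∑-const (x ∷ xs) m = cong (m +_) (∑-const xs m)

∑-1 : ∀ (xs : List A) → ∑ xs (λ _ → 1) ≡ length xs
∑-1 xs = trans (∑-const xs 1) (*-identityʳ _)

∑-++ : ∀ (xs ys : List A) (f : A → ℕ) → ∑ (xs ++ ys) f ≡ ∑ xs f + ∑ ys f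
∑-++ []       ys f = refl
∑-++ (x ∷ xs) ys f = trans (cong (f x +_) (∑-++ xs ys f)) (sym (+-assoc (f x) _ _))

∑-map : ∀ (h : A → B) (xs : List A) (f : B → ℕ) → ∑ (map h xs) f ≡ ∑ xs (f ∘ h)
∑-map h []       f = refl
∑-map h (x ∷ xs) f = cong (f (h x) +_) (∑-map h xs f)

∑-swap : ∀ (xs : List A) (ys : List B) (f : A → B → ℕ) →
  ∑ xs (λ x → ∑ ys (f x)) ≡ ∑ ys (λ y → ∑ xs (λ x → f x y))
∑-swap []       ys f = sym (trans (∑-const ys 0) (*-zeroʳ (length ys)))
∑-swap (x ∷ xs) ys f = trans (cong (∑ ys (f x) +_) (∑-swap xs ys f)) (sym (∑-+ ys (f x) _))

∑-split : ∀ {P : A → Set} (P? : Decidable P) (xs : List A) (f : A → ℕ) →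
  ∑ xs f ≡ ∑ (filter P? xs) f + ∑ (filter (¬? ∘ P?) xs) f
∑-split P? []       f = refl
∑-split P? (x ∷ xs) f with P? x
... | yes _ = trans (cong (f x +_) (∑-split P? xs f)) (sym (+-assoc (f x) _ _))
... | no  _ = begin
  f x + ∑ xs f       ≡⟨ cong (f x +_) (∑-split P? xs f) ⟩
  f x + (Y + N)      ≡⟨ swap-front (f x) Y N ⟩
  Y + (f x + N)      ∎
  where
  open ≡-Reasoning
  Y = ∑ (filter P? xs) f
  N = ∑ (filter (¬? ∘ P?) xs) f

length-split : ∀ {P : A → Set} (P? : Decidable P) (xs : List A) →
  length xs ≡ length (filter P? xs) + length (filter (¬? ∘ P?) xs)
length-split P? xs = begin
  length xs                ≡⟨ ∑-1 xs ⟨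
  ∑ xs (λ _ → 1)           ≡⟨ ∑-split P? xs _ ⟩
  ∑ ys (λ _ → 1) + ∑ zs (λ _ → 1) ≡⟨ cong₂ _+_ (∑-1 ys) (∑-1 zs) ⟩
  length ys + length zs    ∎
  where
  open ≡-Reasoning
  ys = filter P? xs
  zs = filter (¬? ∘ P?) xs

-- Only `xs` must be free of repetitions: each of its entries is cancelled against one occurrence in
-- `ys`. With `f` constantly 1 this is the pigeonhole principle.
∑-⊆ : ∀ {xs ys : List A} (f : A → ℕ) → Unique xs → xs ⊆ ys → ∑ xs f ≤ ∑ ys f
∑-⊆ {xs = []}     f []        xs⊆ys = z≤n
∑-⊆ {xs = x ∷ xs} f (x∉ ∷ xs!) xs⊆ys with ∈-∃++ (xs⊆ys (here refl))
... | ps , qs , refl = begin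
  f x + ∑ xs f             ≤⟨ +-monoʳ-≤ (f x) (∑-⊆ f xs! xs⊆ps++qs) ⟩
  f x + ∑ (ps ++ qs) f     ≡⟨ cong (f x +_) (∑-++ ps qs f) ⟩
  f x + (∑ ps f + ∑ qs f)  ≡⟨ swap-front (f x) (∑ ps f) _ ⟩
  ∑ ps f + (f x + ∑ qs f)  ≡⟨ ∑-++ ps (x ∷ qs) f ⟨
  ∑ (ps ++ x ∷ qs) f       ∎
  where
  open ≤-Reasoning
  xs⊆ps++qs : xs ⊆ ps ++ qs
  xs⊆ps++qs y∈xs with ∈-++⁻ ps (xs⊆ys (there y∈xs))
  ... | inj₁ y∈ps         = ∈-++⁺ˡ y∈ps
  ... | inj₂ (here refl)  = contradiction refl (All.lookup x∉ y∈xs)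
  ... | inj₂ (there y∈qs) = ∈-++⁺ʳ ps y∈qs

length-⊆ : ∀ {xs ys : List A} → Unique xs → xs ⊆ ys → length xs ≤ length ys
length-⊆ {xs = xs} {ys} xs! xs⊆ys =
  subst₂ _≤_ (∑-1 xs) (∑-1 ys) (∑-⊆ (λ _ → 1) xs! xs⊆ys)

-- Reindexing along an injection cannot increase the sum; apply this to `π` and to its inverse.
∑-permute : ∀ {n} (π : Fin n ↔ Fin n) (f : Fin n → ℕ) →
  ∑ (allFin n) (f ∘ Inverse.to π) ≡ ∑ (allFin n) f
∑-permute {n} π f = ≤-antisym (reindex-≤ to to-injective f)
  (subst (_≤ ∑ (allFin n) (f ∘ to))
         (∑-cong (allFin n) λ i → cong f (strictlyInverseˡ i))
         (reindex-≤ from from-injective (f ∘ to)))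
  where
  open Inverse π using (to; from; strictlyInverseˡ; strictlyInverseʳ)
  to-injective : ∀ {i j} → to i ≡ to j → i ≡ j
  to-injective {i} {j} eq =
    trans (sym (strictlyInverseʳ i)) (trans (cong from eq) (strictlyInverseʳ j))
  from-injective : ∀ {i j} → from i ≡ from j → i ≡ j
  from-injective {i} {j} eq =
    trans (sym (strictlyInverseˡ i)) (trans (cong to eq) (strictlyInverseˡ j))
  reindex-≤ : ∀ (h : Fin n → Fin n) → (∀ {i j} → h i ≡ h j → i ≡ j) → (g : Fin n → ℕ) →
    ∑ (allFin n) (g ∘ h) ≤ ∑ (allFin n) g
  reindex-≤ h h-inj g = subst (_≤ ∑ (allFin n) g) (∑-map h (allFin n) g)
    (∑-⊆ g (Unique.map⁺ h-inj (Unique.allFin⁺ n)) (λ _ → ∈-allFin _))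

∑-allFin-suc : ∀ n (f : Fin (suc n) → ℕ) →
  ∑ (allFin (suc n)) f ≡ f zero + ∑ (allFin n) (f ∘ suc)
∑-allFin-suc n f = cong (λ xs → f zero + sum xs)
  (trans (map-tabulate suc f) (sym (map-tabulate id (f ∘ suc))))

-- Walks

-- The index lists every vertex visited, both ends included, so a closing vertex `z` in front of it
-- gives the vertex table of a `Cycle`.
data Walk {V : Set} (R : V → V → Set) : V → V → List V → Set where
  stop : ∀ {x} → Walk R x x (x ∷ [])
  _∷_  : ∀ {x y z vs} → R x y → Walk R y z vs → Walk R x z (x ∷ vs)

walk-snoc : ∀ {V : Set} {R : V → V → Set} {x y z : V} {vs} →
  Walk R x y vs → R y z → Walk R x z (vs ++ z ∷ [])
walk-snoc stop     r = r ∷ stop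
walk-snoc (s ∷ ws) r = s ∷ walk-snoc ws r

walk-step : ∀ {V : Set} {R : V → V → Set} {x y z : V} {vs} → R z x → Walk R x y vs →
  ∀ (i : Fin (length vs)) → R (lookup (z ∷ vs) (inject₁ i)) (lookup (z ∷ vs) (suc i))
walk-step r stop     zero    = r
walk-step r (s ∷ ws) zero    = r
walk-step r (s ∷ ws) (suc i) = walk-step s ws i

walk-last : ∀ {V : Set} {R : V → V → Set} {x y z : V} {vs} → Walk R x y vs →
  lookup (z ∷ vs) (fromℕ (length vs)) ≡ y
walk-last stop     = refl
walk-last (_ ∷ ws) = walk-last ws

lookup-injective : ∀ {xs : List A} → Unique xs → ∀ i j → lookup xs i ≡ lookup xs j → i ≡ j
lookup-injective (_ ∷ _)   zero    zero    _  = refl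
lookup-injective {xs = x ∷ xs} (x∉ ∷ _) zero (suc j) eq = contradiction eq (All.lookup x∉ (∈-lookup {xs = xs} j))
lookup-injective u@(_ ∷ _) (suc i) zero    eq = sym (lookup-injective u zero (suc i) (sym eq))
lookup-injective (_ ∷ xs!) (suc i) (suc j) eq = cong suc (lookup-injective xs! i j eq)

Unique-snoc : ∀ {xs : List A} {z} → Unique xs → All (_≢ z) xs → Unique (xs ++ z ∷ [])
Unique-snoc xs! xs≢z = Unique.++⁺ xs! ([] ∷ [])
  λ { (z∈xs , here refl) → All.lookup xs≢z z∈xs refl }

length-snoc : ∀ (xs : List A) z → length (xs ++ z ∷ []) ≡ suc (length xs)
length-snoc xs z = trans (length-++ xs) (+-comm (length xs) 1)

-- Counting non-adjacent pairs

ι : Bool → ℕ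
ι true  = 1
ι false = 0

-- This is (x - 5)² ≥ 0; writing x = 5 + d for large x avoids truncated subtraction.
square-bound : ∀ x → 10 * x ≤ 25 + x * x
square-bound 0 = m≤m+n _ _
square-bound 1 = m≤m+n _ _
square-bound 2 = m≤m+n _ _
square-bound 3 = m≤m+n _ _
square-bound 4 = m≤m+n _ _
square-bound (suc (suc (suc (suc (suc d))))) =
  subst (10 * (5 + d) ≤_) (sym (complete-square d)) (m≤m+n _ (d * d))
  where
  complete-square : ∀ d → 25 + (5 + d) * (5 + d) ≡ 10 * (5 + d) + d * d
  complete-square = solve-∀

minimiser : ∀ {A : Set} (f : A → ℕ) x xs →
  ∃ λ m → m ∈ x ∷ xs × (∀ {y} → y ∈ x ∷ xs → f m ≤ f y)
minimiser f x []       = x , here refl , λ { (here refl) → ≤-refl }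
minimiser f x (y ∷ ys) with minimiser f y ys
... | m , m∈ , m-min with ≤-total (f x) (f m)
...   | inj₁ fx≤fm = x , here refl , λ
  { (here refl) → ≤-refl ; (there z∈) → ≤-trans fx≤fm (m-min z∈) }
...   | inj₂ fm≤fx = m , there m∈ , λ { (here refl) → fm≤fx ; (there z∈) → m-min z∈ }

module _ {n : ℕ} (G : SignedGraph n) where

  private
    V = Fin n

  Adj : V → V → Set
  Adj u v = T (adj G u v)

  Adj? : ∀ u → Decidable (Adj u)
  Adj? u v = T? (adj G u v)

  Adj-sym : ∀ {u v} → Adj u v → Adj v u
  Adj-sym {u} {v} = subst T (adj-sym G u v)

  Adj⇒≢ : ∀ {u v} → Adj u v → u ≢ v
  Adj⇒≢ {u} uv refl = subst T (loopless G u) uv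

  non : V → V → ℕ
  non u v = ι (not (adj G u v))

  non-sym : ∀ u v → non u v ≡ non v u
  non-sym u v = cong (ι ∘ not) (adj-sym G u v)

  ¬Adj⇒non≡1 : ∀ {u v} → ¬ Adj u v → non u v ≡ 1
  ¬Adj⇒non≡1 {u} {v} ¬uv with adj G u v
  ... | true  = contradiction tt ¬uv
  ... | false = refl

  nonDegree : List V → V → ℕ
  nonDegree S v = ∑ S (non v)

  -- Non-edges are counted as ordered pairs, loops included.
  nonEdges : List V → ℕ
  nonEdges S = ∑ S (nonDegree S)

  length-nonNeighbours-≤ : ∀ S v → length (filter (¬? ∘ Adj? v) S) ≤ nonDegree S v
  length-nonNeighbours-≤ S v = begin
    length N                                     ≡⟨ ∑-1 N ⟨
    ∑ N (λ _ → 1)                                ≤⟨ ∑-mono N (λ w∈N → ≤-reflexive (sym (¬Adj⇒non≡1 (proj₂ (∈-filter⁻ (¬? ∘ Adj? v) {xs = S} w∈N))))) ⟩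
    ∑ N (non v)                                  ≤⟨ m≤n+m _ _ ⟩
    ∑ (filter (Adj? v) S) (non v) + ∑ N (non v)  ≡⟨ ∑-split (Adj? v) S (non v) ⟨
    nonDegree S v                                ∎
    where
    open ≤-Reasoning
    N = filter (¬? ∘ Adj? v) S

  -- Greedy minimum-degree argument behind Turán's theorem: deleting a vertex v of least non-degree
  -- together with its x non-neighbours destroys at least x² ordered non-edges, and 25 + x² ≥ 10 x.
  turán : ∀ m S → length S ≤ m → ∃ λ C →
    AllPairs Adj C × C ⊆ S × 10 * length S ≤ 25 * length C + nonEdges S
  turán m       []      _   = [] , [] , (λ ()) , z≤n
  turán zero    (_ ∷ _) ()
  turán (suc m) S@(s ∷ S₀) ∣S∣≤1+m with minimiser (nonDegree S) s S₀
  ... | v , v∈S , v-min = extend (turán m S′ (≤-trans (≤-pred (begin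
      suc (length S′)        ≤⟨ +-monoˡ-≤ (length S′) (length-⊆ ([] ∷ []) λ { (here refl) → v∈N }) ⟩
      length N + length S′   ≡⟨ +-comm (length N) _ ⟩
      length S′ + length N   ≡⟨ length-split (Adj? v) S ⟨
      length S               ∎)) (≤-pred ∣S∣≤1+m)))
    where
    open ≤-Reasoning
    S′ = filter (Adj? v) S
    N  = filter (¬? ∘ Adj? v) S
    -- Loops count as non-edges, so `v` is deleted with its non-neighbours and `S′` is strictly
    -- shorter.
    v∈N : v ∈ N
    v∈N = ∈-filter⁺ (¬? ∘ Adj? v) v∈S λ vv → Adj⇒≢ vv refl
    drop-N : ∀ u → nonDegree S′ u ≤ nonDegree S u
    drop-N u = subst (nonDegree S′ u ≤_) (sym (∑-split (Adj? v) S (non u))) (m≤m+n _ _)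
    -- Every deleted row is at least as heavy as the row of `v`, by minimality, and that row has
    -- weight at least `length N`.
    nonEdges-drop : nonEdges S′ + length N * length N ≤ nonEdges S
    nonEdges-drop = begin
      nonEdges S′ + length N * length N
        ≤⟨ +-mono-≤ (∑-mono S′ (λ {u} _ → drop-N u)) (*-monoʳ-≤ (length N) (length-nonNeighbours-≤ S v)) ⟩
      ∑ S′ (nonDegree S) + length N * nonDegree S v
        ≡⟨ cong (∑ S′ (nonDegree S) +_) (∑-const N _) ⟨
      ∑ S′ (nonDegree S) + ∑ N (λ _ → nonDegree S v)
        ≤⟨ +-monoʳ-≤ (∑ S′ (nonDegree S)) (∑-mono N λ u∈N → v-min (proj₁ (∈-filter⁻ (¬? ∘ Adj? v) {xs = S} u∈N))) ⟩
      ∑ S′ (nonDegree S) + ∑ N (nonDegree S)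
        ≡⟨ ∑-split (Adj? v) S (nonDegree S) ⟨
      nonEdges S ∎
    rearrange : ∀ c w x → (25 * c + w) + (25 + x) ≡ 25 * suc c + (w + x)
    rearrange = solve-∀
    extend : (∃ λ C → AllPairs Adj C × C ⊆ S′ × 10 * length S′ ≤ 25 * length C + nonEdges S′) →
      ∃ λ C → AllPairs Adj C × C ⊆ S × 10 * length S ≤ 25 * length C + nonEdges S
    extend (C , C-clique , C⊆S′ , bound) =
      v ∷ C , All.tabulate (λ c∈C → proj₂ (∈-filter⁻ (Adj? v) {xs = S} (C⊆S′ c∈C))) ∷ C-clique ,
      (λ { (here refl) → v∈S ; (there c∈C) → proj₁ (∈-filter⁻ (Adj? v) {xs = S} (C⊆S′ c∈C)) }) ,
      (begin
      10 * length S                      ≡⟨ cong (10 *_) (length-split (Adj? v) S) ⟩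
      10 * (length S′ + length N)        ≡⟨ *-distribˡ-+ 10 (length S′) _ ⟩
      10 * length S′ + 10 * length N     ≤⟨ +-mono-≤ bound (square-bound (length N)) ⟩
      (25 * length C + nonEdges S′) + (25 + length N * length N)
                                         ≡⟨ rearrange (length C) (nonEdges S′) _ ⟩
      25 * suc (length C) + (nonEdges S′ + length N * length N)
                                         ≤⟨ +-monoʳ-≤ (25 * suc (length C)) nonEdges-drop ⟩
      25 * suc (length C) + nonEdges S   ∎)

  ∈⇒nonDegree≥1 : ∀ S {v} → v ∈ S → 1 ≤ nonDegree S v
  ∈⇒nonDegree≥1 S {v} v∈S = begin
    1              ≡⟨ cong (_+ 0) (¬Adj⇒non≡1 (λ vv → Adj⇒≢ vv refl)) ⟨
    ∑ (v ∷ []) (non v) ≤⟨ ∑-⊆ (non v) ([] ∷ []) (λ { (here refl) → v∈S }) ⟩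
    nonDegree S v  ∎
    where open ≤-Reasoning

  ¬Adj⇒nonDegree≥2 : ∀ S {v w} → v ∈ S → w ∈ S → v ≢ w → ¬ Adj v w → 2 ≤ nonDegree S v
  ¬Adj⇒nonDegree≥2 S {v} {w} v∈S w∈S v≢w ¬vw = begin
    2
      ≡⟨ cong₂ (λ a b → a + (b + 0)) (¬Adj⇒non≡1 λ vv → Adj⇒≢ vv refl) (¬Adj⇒non≡1 ¬vw) ⟨
    ∑ (v ∷ w ∷ []) (non v)
      ≤⟨ ∑-⊆ (non v) ((v≢w ∷ []) ∷ [] ∷ []) (λ { (here refl) → v∈S ; (there (here refl)) → w∈S }) ⟩
    nonDegree S v ∎
    where open ≤-Reasoning

  length≤nonEdges : ∀ S → length S ≤ nonEdges S
  length≤nonEdges S = subst (_≤ nonEdges S) (∑-1 S) (∑-mono S (∈⇒nonDegree≥1 S))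

  ∑-tight : ∀ {A : Set} (S : List A) (f : A → ℕ) → (∀ {v} → v ∈ S → 1 ≤ f v) → ∑ S f ≤ length S →
    ∀ {v} → v ∈ S → f v ≤ 1
  ∑-tight (s ∷ S) f f≥1 ∑≤ (here refl) = +-cancelʳ-≤ (length S) _ _ (begin
    f s + length S      ≡⟨ cong (f s +_) (∑-1 S) ⟨
    f s + ∑ S (λ _ → 1) ≤⟨ +-monoʳ-≤ (f s) (∑-mono S (f≥1 ∘ there)) ⟩
    f s + ∑ S f         ≤⟨ ∑≤ ⟩
    1 + length S        ∎)
    where open ≤-Reasoning
  ∑-tight (s ∷ S) f f≥1 ∑≤ (there v∈S) = ∑-tight S f (f≥1 ∘ there)
    (≤-pred (≤-trans (+-monoˡ-≤ (∑ S f) (f≥1 (here refl))) ∑≤)) v∈S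

  -- The loops alone already account for `length S`, so no other non-edge fits.
  nonEdges≤length⇒complete : ∀ S → nonEdges S ≤ length S →
    ∀ {v w} → v ∈ S → w ∈ S → v ≢ w → Adj v w
  nonEdges≤length⇒complete S tight {v} {w} v∈S w∈S v≢w with Adj? v w
  ... | yes vw = vw
  ... | no ¬vw = contradiction
    (≤-trans (¬Adj⇒nonDegree≥2 S v∈S w∈S v≢w ¬vw)
             (∑-tight S (nonDegree S) (∈⇒nonDegree≥1 S) tight v∈S)) λ { (s≤s ()) }

  nonEdges-split : ∀ {P : V → Set} (P? : Decidable P) S →
    let Y = filter P? S ; N = filter (¬? ∘ P?) S in
    nonEdges S ≡ nonEdges Y + nonEdges N + 2 * ∑ N (nonDegree Y)
  nonEdges-split P? S = begin
    nonEdges S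
      ≡⟨ ∑-split P? S (nonDegree S) ⟩
    ∑ Y (nonDegree S) + ∑ N (nonDegree S)
      ≡⟨ cong₂ _+_ (splitOver Y) (splitOver N) ⟩
    (nonEdges Y + ∑ Y (nonDegree N)) + (X + nonEdges N)
      ≡⟨ cong (λ m → (nonEdges Y + m) + (X + nonEdges N)) transposed ⟩
    (nonEdges Y + X) + (X + nonEdges N)
      ≡⟨ rearrange (nonEdges Y) X (nonEdges N) ⟩
    nonEdges Y + nonEdges N + 2 * X ∎
    where
    open ≡-Reasoning
    Y = filter P? S
    N = filter (¬? ∘ P?) S
    X = ∑ N (nonDegree Y)
    splitOver : ∀ Z → ∑ Z (nonDegree S) ≡ ∑ Z (nonDegree Y) + ∑ Z (nonDegree N)
    splitOver Z = trans (∑-cong Z (λ z → ∑-split P? S (non z))) (∑-+ Z (nonDegree Y) (nonDegree N))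
    transposed : ∑ Y (nonDegree N) ≡ X
    transposed = trans (∑-swap Y N non) (∑-cong N λ v → ∑-cong Y λ y → non-sym y v)
    rearrange : ∀ a x b → (a + x) + (x + b) ≡ a + b + 2 * x
    rearrange = solve-∀

  Two : (V → Set) → V → Set
  Two S v = ∃ λ a → ∃ λ b → a ≢ b × (S a × Adj v a) × (S b × Adj v b)

  abstract
    Two? : ∀ {S} → Decidable S → Decidable (Two S)
    Two? S? v = any? λ a → any? λ b →
      ¬? (a ≟ᶠ b) ×-dec ((S? a ×-dec Adj? v a) ×-dec (S? b ×-dec Adj? v b))

  Two-mono : ∀ {S S′ : V → Set} → (∀ {v} → S v → S′ v) → ∀ {v} → Two S v → Two S′ v
  Two-mono S⊆S′ (a , b , a≢b , (Sa , va) , (Sb , vb)) =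
    a , b , a≢b , (S⊆S′ Sa , va) , (S⊆S′ Sb , vb)

  ¬Two⇒nonDegree : ∀ {S : V → Set} xs → Unique xs → (∀ {x} → x ∈ xs → S x) →
    ∀ {v} → ¬ Two S v → length xs ≤ 1 + nonDegree xs v
  ¬Two⇒nonDegree xs xs! xs⊆S {v} ¬two =
    subst (_≤ 1 + nonDegree xs v) (sym (length-split (Adj? v) xs))
      (+-mono-≤ (atMostOne (filter (Adj? v) xs) (Unique.filter⁺ (Adj? v) xs!) (∈-filter⁻ (Adj? v) {xs = xs}))
                (length-nonNeighbours-≤ xs v))
    where
    atMostOne : ∀ ys → Unique ys → (∀ {y} → y ∈ ys → y ∈ xs × Adj v y) → length ys ≤ 1
    atMostOne []           _ _ = z≤n
    atMostOne (_ ∷ [])     _ _ = s≤s z≤n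
    atMostOne (a ∷ b ∷ ys) ((a≢b ∷ _) ∷ _) nbr =
      let a∈xs , va = nbr (here refl) ; b∈xs , vb = nbr (there (here refl)) in
      contradiction (a , b , a≢b , (xs⊆S a∈xs , va) , (xs⊆S b∈xs , vb)) ¬two


-- Signs along walks

signAlong : ∀ {V : Set} → (V → V → Sign) → List V → Sign
signAlong f (x ∷ y ∷ ys) = f x y · signAlong f (y ∷ ys)
signAlong f _            = pos

-- Turns the index-based fold of `cycleSign` into a recursion on vertex lists; `s₀` will be the sign
-- of the closing edge.
signAlong-foldr : ∀ {V : Set} (f : V → V → Sign) z vs s₀ →
  foldr (λ i s → f (lookup (z ∷ vs) (inject₁ i)) (lookup (z ∷ vs) (suc i)) · s) s₀ (allFin (length vs))
    ≡ signAlong f (z ∷ vs) · s₀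
signAlong-foldr f z []       s₀ = refl
signAlong-foldr f z (y ∷ ys) s₀ = begin
  f z y · foldr body s₀ (tabulate suc)
    ≡⟨ cong (λ is → f z y · foldr body s₀ is) (map-tabulate id suc) ⟨
  f z y · foldr body s₀ (map suc (allFin (length ys)))
    ≡⟨ cong (f z y ·_) (foldr-map body suc s₀ (allFin (length ys))) ⟩
  f z y · foldr (λ i → body (suc i)) s₀ (allFin (length ys))
    ≡⟨ cong (f z y ·_) (signAlong-foldr f y ys s₀) ⟩
  f z y · (signAlong f (y ∷ ys) · s₀)
    ≡⟨ ·-assoc (f z y) _ s₀ ⟨
  signAlong f (z ∷ y ∷ ys) · s₀ ∎
  where
  open ≡-Reasoning
  body = λ i s → f (lookup (z ∷ y ∷ ys) (inject₁ i)) (lookup (z ∷ y ∷ ys) (suc i)) · s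

signAlong-∷ : ∀ {V : Set} {R : V → V → Set} (f : V → V → Sign) {x y z vs} → Walk R x y vs →
  signAlong f (z ∷ vs) ≡ f z x · signAlong f vs
signAlong-∷ f stop    = refl
signAlong-∷ f (_ ∷ _) = refl

signAlong-pos : ∀ {V : Set} {R : V → V → Set} {S : V → Set} (f : V → V → Sign) →
  (∀ {u v} → S u → S v → R u v → f u v ≡ pos) →
  ∀ {x y vs} → Walk R x y vs → All S vs → signAlong f vs ≡ pos
signAlong-pos f f-pos stop     _           = refl
signAlong-pos f f-pos (r ∷ ws) (Sx ∷ Svs) = begin
  _  ≡⟨ signAlong-∷ f ws ⟩
  _  ≡⟨ cong₂ _·_ (f-pos Sx (walk-start ws Svs) r) (signAlong-pos f f-pos ws Svs) ⟩
  pos ∎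
  where
  open ≡-Reasoning
  walk-start : ∀ {V : Set} {R : V → V → Set} {S : V → Set} {x y vs} → Walk R x y vs → All S vs → S x
  walk-start stop    (Sx ∷ _) = Sx
  walk-start (_ ∷ _) (Sx ∷ _) = Sx

-- The product of m − 1 negative signs, for m ≥ 1.
alternating : ℕ → Sign
alternating zero    = neg
alternating (suc m) = neg · alternating m

alternating-even : ∀ k → alternating (k + k) ≡ neg
alternating-even zero    = refl
alternating-even (suc k) = begin
  neg · alternating (k + suc k)   ≡⟨ cong (λ m → neg · alternating m) (+-suc k k) ⟩
  neg · (neg · alternating (k + k)) ≡⟨ cong (λ s → neg · (neg · s)) (alternating-even k) ⟩
  neg ∎
  where open ≡-Reasoning

signAlong-neg : ∀ {V : Set} {R : V → V → Set} {S : V → Set} (f : V → V → Sign) →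
  (∀ {u v} → S u → S v → R u v → f u v ≡ neg) →
  ∀ {x y vs} → Walk R x y vs → All S vs → signAlong f vs ≡ alternating (length vs)
signAlong-neg f f-neg stop     _ = refl
signAlong-neg f f-neg (r ∷ stop)     (Sx ∷ Sy ∷ []) = cong (_· pos) (f-neg Sx Sy r)
signAlong-neg f f-neg (r ∷ ws@(_ ∷ _)) (Sx ∷ Svs@(Sy ∷ _)) =
  cong₂ _·_ (f-neg Sx Sy r) (signAlong-neg f f-neg ws Svs)

-- Switched signs in a graph without negative (2k+1)-cycles

module Switching {n : ℕ} (G : SignedGraph n) (k t : ℕ) (2k≡6+t : k + k ≡ 6 + t)
                 (free : NegOddCycleFree G k) where

  private
    V = Fin n
    Edge = Adj G

  twist : (V → Sign) → V → V → Sign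
  twist θ u v = θ u · (σ G u v · θ v)

  twist-sym : ∀ θ {u v} → Edge u v → twist θ u v ≡ twist θ v u
  twist-sym θ {u} {v} uv =
    trans (cong (λ s → θ u · (s · θ v)) (σ-sym G u v uv)) (conj-sym (θ u) (σ G v u) (θ v))

  -- Each inner vertex contributes its switching sign twice, so only the two ends survive.
  signAlong-twist : ∀ θ {x y vs} → Walk Edge x y vs →
    signAlong (twist θ) vs ≡ θ x · (signAlong (σ G) vs · θ y)
  signAlong-twist θ {x} stop = sym (·-self (θ x))
  signAlong-twist θ {x} {y} (_∷_ {y = x′} {vs = vs} _ ws) = begin
    signAlong (twist θ) (x ∷ vs)
      ≡⟨ signAlong-∷ (twist θ) ws ⟩
    twist θ x x′ · signAlong (twist θ) vs
      ≡⟨ cong (twist θ x x′ ·_) (signAlong-twist θ ws) ⟩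
    twist θ x x′ · (θ x′ · (signAlong (σ G) vs · θ y))
      ≡⟨ conj-telescope (θ x) _ (θ x′) _ (θ y) ⟩
    θ x · ((σ G x x′ · signAlong (σ G) vs) · θ y)
      ≡⟨ cong (λ s → θ x · (s · θ y)) (signAlong-∷ (σ G) ws) ⟨
    θ x · (signAlong (σ G) (x ∷ vs) · θ y) ∎
    where open ≡-Reasoning

  cycle-pos : ∀ {x y z vs} → Walk Edge x y vs → Edge z x → Edge y z → Unique (z ∷ vs) →
    length vs ≡ k + k → signAlong (σ G) (z ∷ vs) · σ G y z ≡ pos
  cycle-pos {x} {y} {z} {vs} ws zx yz zvs! len with signAlong (σ G) (z ∷ vs) · σ G y z in sgn
  ... | pos = refl
  ... | neg = contradiction (subst (HasNegCycle G) len (C , C-neg)) free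
    where
    C : Cycle G (length vs)
    C = record
      { c        = lookup (z ∷ vs)
      ; length≥3 = s≤s (subst (2 ≤_) (sym (trans len 2k≡6+t)) (s≤s (s≤s z≤n)))
      ; inj      = lookup-injective zvs!
      ; step     = walk-step zx ws
      ; close    = subst (λ v → Edge v z) (sym (walk-last {z = z} ws)) yz }
    C-neg : cycleSign C ≡ neg
    C-neg = begin
      cycleSign C
        ≡⟨ signAlong-foldr (σ G) z vs _ ⟩
      signAlong (σ G) (z ∷ vs) · σ G (lookup (z ∷ vs) (fromℕ (length vs))) z
        ≡⟨ cong (λ v → signAlong (σ G) (z ∷ vs) · σ G v z) (walk-last {z = z} ws) ⟩
      signAlong (σ G) (z ∷ vs) · σ G y z
        ≡⟨ sgn ⟩
      neg ∎
      where open ≡-Reasoning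

  -- Switching preserves the sign of a closed walk, so positivity of the (2k+1)-cycle `z ∷ vs`
  -- determines one closing edge from the path and the other closing edge. All later sign
  -- comparisons go through this.
  closing-edge : ∀ θ {x y z vs} → Walk Edge x y vs → Edge z x → Edge y z → Unique (z ∷ vs) →
    length vs ≡ 6 + t → twist θ z x ≡ signAlong (twist θ) vs · twist θ y z
  closing-edge θ {x} {y} {z} {vs} ws zx yz zvs! len = ·≡pos⇒≡ _ _ (begin
    twist θ z x · (signAlong (twist θ) vs · twist θ y z)
      ≡⟨ ·-assoc (twist θ z x) _ _ ⟨
    (twist θ z x · signAlong (twist θ) vs) · twist θ y z
      ≡⟨ cong (_· twist θ y z) (signAlong-∷ (twist θ) ws) ⟨
    signAlong (twist θ) (z ∷ vs) · twist θ y z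
      ≡⟨ cong (_· twist θ y z) (signAlong-twist θ (zx ∷ ws)) ⟩
    (θ z · (signAlong (σ G) (z ∷ vs) · θ y)) · (θ y · (σ G y z · θ z))
      ≡⟨ conj-telescope (θ z) _ (θ y) _ (θ z) ⟩
    θ z · ((signAlong (σ G) (z ∷ vs) · σ G y z) · θ z)
      ≡⟨ conj-loop (θ z) _ ⟩
    signAlong (σ G) (z ∷ vs) · σ G y z
      ≡⟨ cycle-pos ws zx yz zvs! (trans len (sym 2k≡6+t)) ⟩
    pos ∎)
    where open ≡-Reasoning

  PositiveOn : (V → Sign) → (V → Set) → Set
  PositiveOn θ S = ∀ {u v} → S u → S v → Edge u v → twist θ u v ≡ pos

  -- Paths are measured by their number of vertices.
  Linked : (V → Set) → ℕ → Set
  Linked S m = ∀ {u w} → S u → S w → u ≢ w →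
    ∃ λ vs → Walk Edge u w vs × Unique vs × length vs ≡ m × All S vs

  outside : ∀ {S : V → Set} {z vs} → ¬ S z → All S vs → All (z ≢_) vs
  outside ¬Sz = All.map λ { Sx refl → ¬Sz Sx }

  outsideʳ : ∀ {S : V → Set} {z vs} → ¬ S z → All S vs → All (_≢ z) vs
  outsideʳ ¬Sz = All.map λ { Sx refl → ¬Sz Sx }

  another : ∀ {S : V → Set} {v} → Two G S v → ∀ w → ∃ λ a → a ≢ w × S a × Edge v a
  another (a , b , a≢b , (Sa , va) , (Sb , vb)) w with a ≟ᶠ w
  ... | no a≢w   = a , a≢w , Sa , va
  ... | yes refl = b , a≢b ∘ sym , Sb , vb

  -- The sign at `v` is chosen to make one selected edge into `S` positive. The default `pos` is
  -- harmless: it is used only when `v` has no edge into `S`.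
  extend : (V → Sign) → {S : V → Set} → Decidable S → V → Sign
  extend θ S? v with any? (λ a → S? a ×-dec Adj? G v a)
  ... | yes (a , _) = σ G v a · θ a
  ... | no  _       = pos

  extend-chooses : ∀ θ {S : V → Set} (S? : Decidable S) {v b} → S b → Edge v b →
    ∃ λ a → S a × Edge v a × extend θ S? v ≡ σ G v a · θ a
  extend-chooses θ S? {v} {b} Sb vb with any? (λ a → S? a ×-dec Adj? G v a)
  ... | yes (a , Sa , va) = a , Sa , va , refl
  ... | no ∄              = contradiction (b , Sb , vb) ∄

  module Extension (θ : V → Sign) {S : V → Set} (S? : Decidable S)
                   (S-pos : PositiveOn θ S) (S-two : ∀ {v} → S v → Two G S v) where

    θ′ : V → Sign
    θ′ = extend θ S?

    -- A vertex of `S` has a neighbour in `S`, and its selected edge is already positive under `θ`;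
    -- this determines the sign at `v`.
    agree : ∀ {v} → S v → θ′ v ≡ θ v
    agree {v} Sv =
      let _ , _ , _ , (Sb , vb) , _ = S-two Sv
          a , Sa , va , θ′v≡ = extend-chooses θ S? Sb vb
      in trans θ′v≡ (sym (·≡pos⇒≡ (θ v) _ (S-pos Sv Sa va)))

    S-pos′ : PositiveOn θ′ S
    S-pos′ {u} {v} Su Sv uv =
      trans (cong₂ (λ s s′ → s · (σ G u v · s′)) (agree Su) (agree Sv)) (S-pos Su Sv uv)

    chosen : ∀ {v b} → S b → Edge v b → ∃ λ a → S a × Edge v a × twist θ′ v a ≡ pos
    chosen {v} Sb vb with extend-chooses θ S? Sb vb
    ... | a , Sa , va , θ′v≡ = a , Sa , va , (begin
      θ′ v · (σ G v a · θ′ a)             ≡⟨ cong₂ (λ s s′ → s · (σ G v a · s′)) θ′v≡ (agree Sa) ⟩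
      (σ G v a · θ a) · (σ G v a · θ a)   ≡⟨ ·-self (σ G v a · θ a) ⟩
      pos                                 ∎)
      where open ≡-Reasoning

    -- A positive path with 2k vertices from `b` to the selected neighbour forces the edge to `b` to
    -- share the sign of the selected edge.
    attach : Linked S (6 + t) → ∀ {v b} → S b → Edge v b → twist θ′ v b ≡ pos
    attach linked {v} {b} Sb vb with S? v
    ... | yes Sv = S-pos′ Sv Sb vb
    ... | no ¬Sv with chosen Sb vb
    ...   | a , Sa , va , va-pos with b ≟ᶠ a
    ...     | yes refl = va-pos
    ...     | no b≢a with linked Sb Sa b≢a
    ...       | vs , ws , vs! , len , Svs = begin
      twist θ′ v b
        ≡⟨ closing-edge θ′ ws vb (Adj-sym G va) (outside ¬Sv Svs ∷ vs!) len ⟩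
      signAlong (twist θ′) vs · twist θ′ a v
        ≡⟨ cong₂ _·_ (signAlong-pos (twist θ′) S-pos′ ws Svs)
                     (trans (twist-sym θ′ (Adj-sym G va)) va-pos) ⟩
      pos ∎
      where open ≡-Reasoning

    -- The cycle runs v, w, b, ..., a: its stretch inside `S` has 2k - 1 vertices, and every edge
    -- except possibly `vw` is known to be positive.
    cross : Linked S (6 + t) → Linked S (5 + t) → ∀ {v w a b} → ¬ S v → ¬ S w → Edge v w →
      S a → S b → a ≢ b → Edge v a → Edge w b → twist θ′ v w ≡ pos
    cross linked linked⁻ {v} {w} {a} {b} ¬Sv ¬Sw vw Sa Sb a≢b va wb with linked⁻ Sb Sa (a≢b ∘ sym)
    ... | vs , ws , vs! , len , Svs = begin
      twist θ′ v w
        ≡⟨ closing-edge θ′ (wb ∷ ws) vw (Adj-sym G va)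
             ((Adj⇒≢ G vw ∷ outside ¬Sv Svs) ∷ outside ¬Sw Svs ∷ vs!) (cong suc len) ⟩
      signAlong (twist θ′) (w ∷ vs) · twist θ′ a v
        ≡⟨ cong₂ _·_ (signAlong-∷ (twist θ′) ws)
                     (trans (twist-sym θ′ (Adj-sym G va)) (attach linked Sa va)) ⟩
      (twist θ′ w b · signAlong (twist θ′) vs) · pos
        ≡⟨ cong₂ (λ s s′ → (s · s′) · pos) (attach linked Sb wb)
                 (signAlong-pos (twist θ′) S-pos′ ws Svs) ⟩
      pos ∎
      where open ≡-Reasoning

    Two-pos : Linked S (6 + t) → Linked S (5 + t) → PositiveOn θ′ (Two G S)
    Two-pos linked linked⁻ {u} {v} Tu Tv uv with S? u | S? v
    ... | _      | yes Sv = attach linked Sv uv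
    ... | yes Su | no _   = trans (twist-sym θ′ uv) (attach linked Su (Adj-sym G uv))
    ... | no ¬Su | no ¬Sv =
      -- Of the two neighbours of `u`, one differs from the neighbour `b` of `v`, as `cross`
      -- requires.
      let b , _ , _ , (Sb , vb) , _ = Tv
          a , a≢b , Sa , ua = another Tu b
      in cross linked linked⁻ ¬Su ¬Sv uv Sa Sb a≢b ua vb

  -- An end outside `S` enters through a neighbour in `S` and cannot recur on a path inside `S`. The
  -- three lengths assumed serve two, one or no such ends.
  Two-linked : ∀ {S : V → Set} (S? : Decidable S) → (∀ {v} → S v → Two G S v) → ∀ {m} →
    Linked S m → Linked S (1 + m) → Linked S (2 + m) → Linked (Two G S) (2 + m)
  Two-linked S? S-two linked₀ linked₁ linked₂ {u} {w} Tu Tw u≢w with S? u | S? w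
  ... | yes Su | yes Sw with linked₂ Su Sw u≢w
  ...   | vs , ws , vs! , len , Svs = vs , ws , vs! , len , All.map S-two Svs
  Two-linked S? S-two linked₀ linked₁ linked₂ {u} {w} Tu Tw u≢w | no ¬Su | yes Sw with another Tu w
  ...   | a , a≢w , Sa , ua with linked₁ Sa Sw a≢w
  ...     | vs , ws , vs! , len , Svs =
    u ∷ vs , ua ∷ ws , outside ¬Su Svs ∷ vs! , cong suc len , Tu ∷ All.map S-two Svs
  Two-linked S? S-two linked₀ linked₁ linked₂ {u} {w} Tu Tw u≢w | yes Su | no ¬Sw with another Tw u
  ...   | b , b≢u , Sb , wb with linked₁ Su Sb (b≢u ∘ sym)
  ...     | vs , ws , vs! , len , Svs =
    vs ++ w ∷ [] , walk-snoc ws (Adj-sym G wb) , Unique-snoc vs! (outsideʳ ¬Sw Svs) ,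
    trans (length-snoc vs w) (cong suc len) , All.++⁺ (All.map S-two Svs) (Tw ∷ [])
  Two-linked S? S-two linked₀ linked₁ linked₂ {u} {w} Tu Tw u≢w | no ¬Su | no ¬Sw
    with Tw
  ... | b , _ , _ , (Sb , wb) , _ with another Tu b
  ...   | a , a≢b , Sa , ua with linked₀ Sa Sb a≢b
  ...     | vs , ws , vs! , len , Svs =
    u ∷ vs ++ w ∷ [] , ua ∷ walk-snoc ws (Adj-sym G wb) ,
    All.++⁺ (outside ¬Su Svs) (u≢w ∷ []) ∷ Unique-snoc vs! (outsideʳ ¬Sw Svs) ,
    cong suc (trans (length-snoc vs w) (cong suc len)) , Tu ∷ All.++⁺ (All.map S-two Svs) (Tw ∷ [])

-- Cliques

clique-adj : ∀ {n} {G : SignedGraph n} {C} → AllPairs (Adj G) C →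
  ∀ {a b} → a ∈ C → b ∈ C → a ≢ b → Adj G a b
clique-adj (a~ ∷ _)  (here refl) (here refl) a≢a = contradiction refl a≢a
clique-adj (a~ ∷ _)  (here refl) (there b∈)  _   = All.lookup a~ b∈
clique-adj {G = G} (b~ ∷ _) (there a∈) (here refl) _ = Adj-sym G (All.lookup b~ a∈)
clique-adj {G = G} (_ ∷ cl) (there a∈) (there b∈) a≢b = clique-adj {G = G} cl a∈ b∈ a≢b

module _ {n : ℕ} where
  open DecMembership (_≟ᶠ_ {n}) using (_∈?_)

  pick : ∀ {C : List (Fin n)} → Unique C → ∀ A s → s + length A ≤ length C →
    ∃ λ Q → length Q ≡ s × Unique Q × All (λ q → q ∈ C × q ∉ A) Q
  pick {C} C! A s bound =
    take s D , trans (length-take s D) (m≤n⇒m⊓n≡m s≤∣D∣) , Unique.take⁺ s (Unique.filter⁺ _ C!) ,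
    All.take⁺ s (All.tabulate (∈-filter⁻ ∉A? {xs = C}))
    where
    ∉A? : Decidable (_∉ A)
    ∉A? q = ¬? (q ∈? A)
    D = filter ∉A? C
    C⊆A++D : C ⊆ A ++ D
    C⊆A++D {q} q∈C with q ∈? A
    ... | yes q∈A = ∈-++⁺ˡ q∈A
    ... | no q∉A  = ∈-++⁺ʳ A (∈-filter⁺ ∉A? q∈C q∉A)
    s≤∣D∣ : s ≤ length D
    s≤∣D∣ = +-cancelʳ-≤ (length A) s _ (begin
      s + length A        ≤⟨ bound ⟩
      length C            ≤⟨ length-⊆ C! C⊆A++D ⟩
      length (A ++ D)     ≡⟨ length-++ A ⟩
      length A + length D ≡⟨ +-comm (length A) _ ⟩
      length D + length A ∎)
      where open ≤-Reasoning

module Clique {n : ℕ} (G : SignedGraph n) (C : List (Fin n)) (C-clique : AllPairs (Adj G) C) where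

  C! : Unique C
  C! = AllPairs.map (Adj⇒≢ G) C-clique

  walk-through : ∀ x Q {y} → Unique (x ∷ Q ++ y ∷ []) → All (_∈ C) (x ∷ Q ++ y ∷ []) →
    Walk (Adj G) x y (x ∷ Q ++ y ∷ [])
  walk-through x [] ((x≢y ∷ []) ∷ _) (x∈ ∷ y∈ ∷ []) = clique-adj {G = G} C-clique x∈ y∈ x≢y ∷ stop
  walk-through x (q ∷ Q) ((x≢q ∷ _) ∷ vs!) (x∈ ∷ vs∈@(q∈ ∷ _)) =
    clique-adj {G = G} C-clique x∈ q∈ x≢q ∷ walk-through q Q vs! vs∈

  abstract
    -- In a clique any `s` remaining vertices, in any order, can serve as the interior; `A` is the
    -- set to be kept off the path.
    tour : ∀ {x y} A s → x ∈ C → y ∈ C → x ∉ A → y ∉ A → x ≢ y → 2 + s + length A ≤ length C →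
      ∃ λ vs → Walk (Adj G) x y vs × Unique vs × length vs ≡ 2 + s × All (λ v → v ∈ C × v ∉ A) vs
    tour {x} {y} A s x∈ y∈ x∉A y∉A x≢y bound
      with pick C! (x ∷ y ∷ A) s (subst (_≤ length C) (sym (shift s (length A))) bound)
      where
      shift : ∀ s a → s + (2 + a) ≡ 2 + s + a
      shift = solve-∀
    ... | Q , ∣Q∣≡s , Q! , Q-avoids =
      x ∷ Q ++ y ∷ [] , walk-through x Q vs! (All.map proj₁ vs∈) , vs! ,
      cong suc (trans (length-snoc Q y) (cong suc ∣Q∣≡s)) , vs∈
      where
      vs! : Unique (x ∷ Q ++ y ∷ [])
      vs! = All.++⁺ (All.map (λ { (_ , q∉) refl → q∉ (here refl) }) Q-avoids) (x≢y ∷ []) ∷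
            Unique-snoc Q! (All.map (λ { (_ , q∉) refl → q∉ (there (here refl)) }) Q-avoids)
      vs∈ : All (λ v → v ∈ C × v ∉ A) (x ∷ Q ++ y ∷ [])
      vs∈ = (x∈ , x∉A) ∷
        All.++⁺ (All.map (λ { (q∈ , q∉) → q∈ , q∉ ∘ there ∘ there }) Q-avoids) ((y∈ , y∉A) ∷ [])

  clique-two : 3 ≤ length C → ∀ {v} → v ∈ C → Two G (_∈ C) v
  clique-two 3≤∣C∣ {v} v∈ with pick C! (v ∷ []) 2 3≤∣C∣
  ... | a ∷ b ∷ [] , refl , (a≢b ∷ []) ∷ _ , (a∈ , a∉) ∷ (b∈ , b∉) ∷ [] =
    a , b , a≢b , (a∈ , edge a∈ a∉) , (b∈ , edge b∈ b∉)
    where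
    edge : ∀ {w} → w ∈ C → w ∉ v ∷ [] → Adj G v w
    edge w∈ w∉ = clique-adj {G = G} C-clique v∈ w∈ λ { refl → w∉ (here refl) }

-- Positivity of a large clique

module CliqueSigns {n : ℕ} (G : SignedGraph n) (k t : ℕ) (2k≡6+t : k + k ≡ 6 + t)
                   (free : NegOddCycleFree G k)
                   (x₀ p q z : Fin n) (C₀ : List (Fin n))
                          (C-clique : AllPairs (Adj G) (x₀ ∷ p ∷ q ∷ z ∷ C₀))
                   (8+t≤∣C∣ : 8 + t ≤ length (x₀ ∷ p ∷ q ∷ z ∷ C₀)) where

  open Switching G k t 2k≡6+t free
  private
    V = Fin n
    Edge = Adj G
    C : List V
    C = x₀ ∷ p ∷ q ∷ z ∷ C₀
  open Clique G C C-clique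

  edge : ∀ {a b} → a ∈ C → b ∈ C → a ≢ b → Edge a b
  edge = clique-adj {G = G} C-clique

  clique-linked : ∀ s → 2 + s ≤ length C → Linked (_∈ C) (2 + s)
  clique-linked s bound x∈ y∈ x≢y
    with tour [] s x∈ y∈ (λ ()) (λ ()) x≢y (subst (_≤ length C) (sym (+-identityʳ (2 + s))) bound)
  ... | vs , ws , vs! , len , vs∈ = vs , ws , vs! , len , All.map proj₁ vs∈

  θ₀ : V → Sign
  θ₀ v with v ≟ᶠ x₀
  ... | yes _ = pos
  ... | no  _ = σ G x₀ v

  star-pos : ∀ {v} → v ≢ x₀ → twist θ₀ x₀ v ≡ pos
  star-pos {v} v≢x₀ with x₀ ≟ᶠ x₀ | v ≟ᶠ x₀
  ... | no x₀≢x₀ | _        = contradiction refl x₀≢x₀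
  ... | yes _    | yes v≡x₀ = contradiction v≡x₀ v≢x₀
  ... | yes _    | no _     = ·-self (σ G x₀ v)

  -- Both signs close up the same path y … x₀ to a (2k+1)-cycle.
  same-at : ∀ {a b y} → a ∈ C → b ∈ C → y ∈ C → a ≢ x₀ → b ≢ x₀ → y ≢ x₀ → y ≢ a → y ≢ b →
    twist θ₀ a y ≡ twist θ₀ b y
  same-at {a} {b} {y} a∈ b∈ y∈ a≢x₀ b≢x₀ y≢x₀ y≢a y≢b
    with tour (a ∷ b ∷ []) (4 + t) y∈ (here refl) (avoid y≢a y≢b) (avoid (a≢x₀ ∘ sym) (b≢x₀ ∘ sym))
              y≢x₀ (subst (_≤ length C) (+-comm 2 (6 + t)) 8+t≤∣C∣)
    where
    avoid : ∀ {x} → x ≢ a → x ≢ b → x ∉ a ∷ b ∷ []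
    avoid x≢a x≢b (here x≡a)         = x≢a x≡a
    avoid x≢a x≢b (there (here x≡b)) = x≢b x≡b
  ... | vs , ws , vs! , len , vs∈ = trans (close-up a∈ a≢x₀ y≢a λ { refl → here refl })
                                          (sym (close-up b∈ b≢x₀ y≢b λ { refl → there (here refl) }))
    where
    close-up : ∀ {c} → c ∈ C → c ≢ x₀ → y ≢ c → (∀ {d} → c ≡ d → d ∈ a ∷ b ∷ []) →
      twist θ₀ c y ≡ signAlong (twist θ₀) vs · pos
    close-up c∈ c≢x₀ y≢c c∈ab = trans
      (closing-edge θ₀ ws (edge c∈ y∈ (y≢c ∘ sym)) (edge (here refl) c∈ (c≢x₀ ∘ sym))
        (All.map (λ { (_ , v∉) c≡v → v∉ (c∈ab c≡v) }) vs∈ ∷ vs!) len)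
      (cong (signAlong (twist θ₀) vs ·_) (star-pos c≢x₀))

  private
    p∈ : p ∈ C
    p∈ = there (here refl)
    q∈ : q ∈ C
    q∈ = there (there (here refl))
    z∈ : z ∈ C
    z∈ = there (there (there (here refl)))
    p≢x₀ : p ≢ x₀
    p≢x₀ = Adj⇒≢ G (All.lookup (AllPairs.head C-clique) (here refl)) ∘ sym
    q≢x₀ : q ≢ x₀
    q≢x₀ = Adj⇒≢ G (All.lookup (AllPairs.head C-clique) (there (here refl))) ∘ sym
    z≢x₀ : z ≢ x₀
    z≢x₀ = Adj⇒≢ G (All.lookup (AllPairs.head C-clique) (there (there (here refl)))) ∘ sym
    p≢q : p ≢ q
    p≢q = Adj⇒≢ G (All.head (AllPairs.head (AllPairs.tail C-clique)))
    p≢z : p ≢ z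
    p≢z = Adj⇒≢ G (All.lookup (AllPairs.head (AllPairs.tail C-clique)) (there (here refl)))
    q≢z : q ≢ z
    q≢z = Adj⇒≢ G (All.head (AllPairs.head (AllPairs.tail (AllPairs.tail C-clique))))

  Rim : V → Set
  Rim v = v ∈ C × v ≢ x₀

  at-p : ∀ {b} → Rim b → p ≢ b → twist θ₀ b p ≡ twist θ₀ q p
  at-p (b∈ , b≢x₀) p≢b = same-at b∈ q∈ p∈ b≢x₀ q≢x₀ p≢x₀ p≢b p≢q

  -- `same-at` replaces one end of an edge while keeping the other, so ab passes to pb and then to
  -- qp; an edge already meeting `p` needs only the second move.
  rim-constant : ∀ {a b} → Rim a → Rim b → Edge a b → twist θ₀ a b ≡ twist θ₀ q p
  rim-constant {a} {b} Ra@(a∈ , a≢x₀) Rb@(b∈ , b≢x₀) ab with p ≟ᶠ b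
  ... | yes refl = at-p Ra (Adj⇒≢ G ab ∘ sym)
  ... | no p≢b with p ≟ᶠ a
  ...   | yes refl = trans (twist-sym θ₀ ab) (at-p Rb p≢b)
  ...   | no p≢a   = begin
    twist θ₀ a b ≡⟨ same-at a∈ p∈ b∈ a≢x₀ p≢x₀ b≢x₀ (Adj⇒≢ G ab ∘ sym) (p≢b ∘ sym) ⟩
    twist θ₀ p b ≡⟨ twist-sym θ₀ (edge p∈ b∈ p≢b) ⟩
    twist θ₀ b p ≡⟨ at-p Rb p≢b ⟩
    twist θ₀ q p ∎
    where open ≡-Reasoning

  -- If all edges avoiding x₀ were negative, so would be a (2k+1)-cycle through them.
  rim-pos : twist θ₀ q p ≡ pos
  rim-pos with twist θ₀ q p ≟ₛ pos
  ... | yes eq = eq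
  ... | no ≢pos with tour (x₀ ∷ z ∷ []) (4 + t) p∈ q∈ (avoid p≢x₀ p≢z) (avoid q≢x₀ q≢z) p≢q
                          (subst (_≤ length C) (+-comm 2 (6 + t)) 8+t≤∣C∣)
    where
    avoid : ∀ {x} → x ≢ x₀ → x ≢ z → x ∉ x₀ ∷ z ∷ []
    avoid x≢x₀ x≢z (here x≡x₀)        = x≢x₀ x≡x₀
    avoid x≢x₀ x≢z (there (here x≡z)) = x≢z x≡z
  ...   | vs , ws , vs! , len , vs∈ = contradiction (begin
    neg
      ≡⟨ rim-neg (z∈ , z≢x₀) (p∈ , p≢x₀) zp ⟨
    twist θ₀ z p
      ≡⟨ closing-edge θ₀ ws zp qz (All.map (λ { (_ , v∉) refl → v∉ (there (here refl)) }) vs∈ ∷ vs!) len ⟩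
    signAlong (twist θ₀) vs · twist θ₀ q z
      ≡⟨ cong₂ _·_ (signAlong-neg (twist θ₀) rim-neg ws
                     (All.map (λ { (v∈ , v∉) → v∈ , λ { refl → v∉ (here refl) } }) vs∈))
                   (rim-neg (q∈ , q≢x₀) (z∈ , z≢x₀) qz) ⟩
    alternating (length vs) · neg
      ≡⟨ cong (λ m → alternating m · neg) (trans len (sym 2k≡6+t)) ⟩
    alternating (k + k) · neg
      ≡⟨ cong (_· neg) (alternating-even k) ⟩
    pos ∎) λ ()
    where
    open ≡-Reasoning
    rim-neg : ∀ {a b} → Rim a → Rim b → Edge a b → twist θ₀ a b ≡ neg
    rim-neg Ra Rb ab = trans (rim-constant Ra Rb ab) (¬pos⇒neg ≢pos)
    zp = edge z∈ p∈ (p≢z ∘ sym)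
    qz = edge q∈ z∈ q≢z

  clique-pos : PositiveOn θ₀ (_∈ C)
  clique-pos {u} {v} u∈ v∈ uv = by-cases (u ≟ᶠ x₀) (v ≟ᶠ x₀)
    where
    by-cases : Dec (u ≡ x₀) → Dec (v ≡ x₀) → twist θ₀ u v ≡ pos
    by-cases (yes refl) _          = star-pos (Adj⇒≢ G uv ∘ sym)
    by-cases (no u≢x₀)  (yes refl) = trans (twist-sym θ₀ uv) (star-pos u≢x₀)
    by-cases (no u≢x₀)  (no v≢x₀)  = trans (rim-constant (u∈ , u≢x₀) (v∈ , v≢x₀) uv) rim-pos


-- Edge counts

length-filterᵇ : ∀ {A : Set} (p : A → Bool) xs → length (filterᵇ p xs) ≡ ∑ xs (ι ∘ p)
length-filterᵇ p []       = refl
length-filterᵇ p (x ∷ xs) with p x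
... | true  = cong suc (length-filterᵇ p xs)
... | false = length-filterᵇ p xs

∑-concatMap : ∀ {A B : Set} (h : A → List B) xs (f : B → ℕ) →
  ∑ (concatMap h xs) f ≡ ∑ xs (λ x → ∑ (h x) f)
∑-concatMap h []       f = refl
∑-concatMap h (x ∷ xs) f = trans (∑-++ (h x) _ f) (cong (∑ (h x) f +_) (∑-concatMap h xs f))

count-allPairs : ∀ n (p : Fin n × Fin n → Bool) →
  length (filterᵇ p (allPairs n)) ≡ ∑ (allFin n) (λ i → ∑ (allFin n) (λ j → ι (p (i , j))))
count-allPairs n p = begin
  length (filterᵇ p (allPairs n))
    ≡⟨ length-filterᵇ p (allPairs n) ⟩
  ∑ (allPairs n) (ι ∘ p)
    ≡⟨ ∑-concatMap _ (allFin n) (ι ∘ p) ⟩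
  ∑ (allFin n) (λ i → ∑ (map (i ,_) (allFin n)) (ι ∘ p))
    ≡⟨ ∑-cong (allFin n) (λ i → ∑-map (i ,_) (allFin n) (ι ∘ p)) ⟩
  ∑ (allFin n) (λ i → ∑ (allFin n) (λ j → ι (p (i , j)))) ∎
  where open ≡-Reasoning

-- Each ordered pair is exactly one of: an edge listed upwards, an edge listed downwards, or
-- non-adjacent, loops included.
handshake : ∀ {n} (G : SignedGraph n) → 2 * e G + nonEdges G (allFin n) ≡ n * n
handshake {n} G = begin
  2 * e G + W
    ≡⟨ cong (λ m → m + W) (cong (e G +_) (+-identityʳ (e G))) ⟩
  e G + e G + W
    ≡⟨ cong (_+ W) (cong₂ _+_ (count-allPairs n _)
                              (trans (count-allPairs n _) (∑-swap V V up))) ⟩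
  ∑ V (λ i → ∑ V (up i)) + ∑ V (λ i → ∑ V (λ j → up j i)) + W
    ≡⟨ cong (_+ W) (∑-+ V _ _) ⟨
  ∑ V (λ i → ∑ V (up i) + ∑ V (λ j → up j i)) + W
    ≡⟨ ∑-+ V _ _ ⟨
  ∑ V (λ i → ∑ V (up i) + ∑ V (λ j → up j i) + ∑ V (non G i))
    ≡⟨ ∑-cong V row ⟩
  ∑ V (λ _ → n)
    ≡⟨ ∑-const V n ⟩
  length V * n
    ≡⟨ cong (_* n) ∣V∣≡n ⟩
  n * n ∎
  where
  open ≡-Reasoning
  V = allFin n
  W = nonEdges G V
  up : Fin n → Fin n → ℕ
  up i j = ι (⌊ toℕ i <? toℕ j ⌋ ∧ adj G i j)
  ∣V∣≡n : length V ≡ n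
  ∣V∣≡n = length-tabulate id
  trichotomy : ∀ i j → up i j + up j i + non G i j ≡ 1
  trichotomy i j rewrite adj-sym G j i with toℕ i <? toℕ j | toℕ j <? toℕ i | adj G i j in ij
  ... | yes i<j | yes j<i | _     = contradiction i<j (<-asym j<i)
  ... | yes _   | no _    | true  = refl
  ... | yes _   | no _    | false = refl
  ... | no _    | yes _   | true  = refl
  ... | no _    | yes _   | false = refl
  ... | no _    | no _    | false = refl
  ... | no i≮j  | no j≮i  | true  = contradiction
    (toℕ-injective (≤-antisym (≮⇒≥ j≮i) (≮⇒≥ i≮j))) (Adj⇒≢ G (subst T (sym ij) tt))
  row : ∀ i → ∑ V (up i) + ∑ V (λ j → up j i) + ∑ V (non G i) ≡ n
  row i = begin
    ∑ V (up i) + ∑ V (λ j → up j i) + ∑ V (non G i)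
      ≡⟨ cong (_+ ∑ V (non G i)) (∑-+ V (up i) _) ⟨
    ∑ V (λ j → up i j + up j i) + ∑ V (non G i)
      ≡⟨ ∑-+ V _ (non G i) ⟨
    ∑ V (λ j → up i j + up j i + non G i j)
      ≡⟨ ∑-cong V (trichotomy i) ⟩
    ∑ V (λ _ → 1)
      ≡⟨ trans (∑-1 V) ∣V∣≡n ⟩
    n ∎

-- The extremal graph

extremalRow : ∀ {m} → Fin m → Fin m → ℕ
extremalRow {m} i j = non (C3⁻·K (2 + m)) (suc (suc i)) (suc (suc j))

extremal-clique-row : ∀ {m} (i : Fin m) → ∑ (allFin m) (extremalRow i) ≡ 1
extremal-clique-row {suc m} zero = trans (∑-allFin-suc m (extremalRow zero))
  (cong suc (trans (∑-const (allFin m) 0) (*-zeroʳ (length (allFin m)))))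
extremal-clique-row {suc m} (suc i) =
  trans (∑-allFin-suc m (extremalRow (suc i))) (extremal-clique-row i)

extremal-clique : ∀ {m} {i j : Fin m} → i ≢ j →
  T (adj (C3⁻·K (2 + m)) (suc (suc i)) (suc (suc j)))
extremal-clique {i = zero}  {zero}  i≢j = contradiction refl i≢j
extremal-clique {i = zero}  {suc j} i≢j = tt
extremal-clique {i = suc i} {zero}  i≢j = tt
extremal-clique {i = suc i} {suc j} i≢j = extremal-clique (i≢j ∘ cong suc)

-- Rows 0 and 1 hold their loop and `m` non-neighbours, row 2 only its loop, and each later row its
-- loop and the vertices 0 and 1.
extremal-nonEdges : ∀ m → nonEdges (C3⁻·K (3 + m)) (allFin (3 + m)) + 12 ≡ 5 * (3 + m)
extremal-nonEdges m = trans (cong (_+ 12) (begin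
  nonEdges H (allFin (3 + m))
    ≡⟨ split₃ (nonDegree H (allFin (3 + m))) ⟩
  nonDegree H (allFin (3 + m)) zero + (nonDegree H (allFin (3 + m)) (suc zero) +
    (nonDegree H (allFin (3 + m)) (suc (suc zero)) +
      ∑ (allFin m) (λ i → nonDegree H (allFin (3 + m)) (suc (suc (suc i))))))
    ≡⟨ cong₂ _+_ (trans (split₃ (non H zero)) (cong suc ones))
        (cong₂ _+_ (trans (split₃ (non H (suc zero))) (cong suc ones))
          (cong₂ _+_ (trans (split₃ (non H (suc (suc zero)))) (cong suc zeros))
            (∑-cong (allFin m) λ i → trans (split₃ (non H (suc (suc (suc i)))))
                                           (cong (2 +_) (extremal-clique-row i))))) ⟩
  (1 + m) + ((1 + m) + (1 + ∑ (allFin m) (λ _ → 3)))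
    ≡⟨ cong (λ s → (1 + m) + ((1 + m) + (1 + s)))
            (trans (∑-const (allFin m) 3) (cong (_* 3) (length-tabulate {n = m} id))) ⟩
  (1 + m) + ((1 + m) + (1 + m * 3)) ∎)) (total m)
  where
  open ≡-Reasoning
  H = C3⁻·K (3 + m)
  split₃ : ∀ (f : Fin (3 + m) → ℕ) → ∑ (allFin (3 + m)) f ≡
    f zero + (f (suc zero) + (f (suc (suc zero)) + ∑ (allFin m) (λ i → f (suc (suc (suc i))))))
  split₃ f = trans (∑-allFin-suc (2 + m) f) (cong (f zero +_)
    (trans (∑-allFin-suc (1 + m) (f ∘ suc)) (cong (f (suc zero) +_) (∑-allFin-suc m λ i → f (suc (suc i))))))
  ones : ∑ (allFin m) (λ _ → 1) ≡ m
  ones = trans (∑-1 (allFin m)) (length-tabulate id)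
  zeros : ∑ (allFin m) (λ _ → 0) ≡ 0
  zeros = trans (∑-const (allFin m) 0) (*-zeroʳ (length (allFin m)))
  total : ∀ m → (1 + m) + ((1 + m) + (1 + m * 3)) + 12 ≡ 5 * (3 + m)
  total = solve-∀

SwitchingEquivalent⇒nonEdges≡ : ∀ {n} {G H : SignedGraph n} → SwitchingEquivalent G H →
  nonEdges G (allFin n) ≡ nonEdges H (allFin n)
SwitchingEquivalent⇒nonEdges≡ {n} {G} {H} (π , _ , adj-eq , _) = begin
  ∑ V (λ i → ∑ V (non G i))
    ≡⟨ ∑-permute π _ ⟨
  ∑ V (λ i → ∑ V (non G (to i)))
    ≡⟨ ∑-cong V (λ i → ∑-permute π (non G (to i))) ⟨
  ∑ V (λ i → ∑ V (λ j → non G (to i) (to j)))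
    ≡⟨ ∑-cong V (λ i → ∑-cong V (λ j → cong (ι ∘ not) (adj-eq i j))) ⟩
  ∑ V (λ i → ∑ V (non H i)) ∎
  where
  open ≡-Reasoning
  open Inverse π using (to)
  V = allFin n

transpose-here : ∀ {n} (i j : Fin n) → Components.transpose i j i ≡ j
transpose-here i j rewrite dec-true (i ≟ᶠ i) refl = refl

transpose-away : ∀ {n} {i j k : Fin n} → k ≢ i → k ≢ j → Components.transpose i j k ≡ k
transpose-away {i = i} {j} {k} k≢i k≢j
  rewrite dec-false (k ≟ᶠ i) k≢i | dec-false (k ≟ᶠ j) k≢j = refl

to-injective : ∀ {n} (π : Fin n ↔ Fin n) {i j} → Inverse.to π i ≡ Inverse.to π j → i ≡ j
to-injective π {i} {j} eq = trans (sym (Inverse.strictlyInverseʳ π i))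
  (trans (cong (Inverse.from π) eq) (Inverse.strictlyInverseʳ π j))

-- Following `π` by a transposition moves only the values `π i` and `r`, so vertices placed earlier
-- stay put.
redirect : ∀ {n} (π : Fin n ↔ Fin n) i r → ∃ λ (ρ : Fin n ↔ Fin n) →
  Inverse.to ρ i ≡ r × (∀ {j} → j ≢ i → Inverse.to π j ≢ r → Inverse.to ρ j ≡ Inverse.to π j)
redirect π i r = π ∘ₚ transpose (Inverse.to π i) r , transpose-here (Inverse.to π i) r ,
  λ j≢i πj≢r → transpose-away (j≢i ∘ to-injective π) πj≢r

relabel : ∀ {m} {r s u : Fin (3 + m)} → r ≢ s → r ≢ u → s ≢ u →
  ∃ λ (π : Fin (3 + m) ↔ Fin (3 + m)) →
    Inverse.to π zero ≡ r × Inverse.to π (suc zero) ≡ s × Inverse.to π (suc (suc zero)) ≡ u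
relabel {r = r} {s} {u} r≢s r≢u s≢u with redirect Permutation.id zero r
... | π , π0≡r , _ with redirect π (suc zero) s
...   | ρ , ρ1≡s , ρ-keeps with redirect ρ (suc (suc zero)) u
...     | τ , τ2≡u , τ-keeps = τ ,
  trans (τ-keeps (λ ()) λ eq → r≢u (trans (sym ρ0≡r) eq)) ρ0≡r ,
  trans (τ-keeps (λ ()) λ eq → s≢u (trans (sym ρ1≡s) eq)) ρ1≡s ,
  τ2≡u
  where
  ρ0≡r = trans (ρ-keeps (λ ()) λ eq → r≢s (trans (sym π0≡r) eq)) π0≡r

T⇒≡true : ∀ {b} → T b → b ≡ true
T⇒≡true {true} _ = refl

¬T⇒≡false : ∀ {b} → ¬ T b → b ≡ false
¬T⇒≡false {true}  ¬t = contradiction tt ¬t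
¬T⇒≡false {false} _  = refl

-- The last hypothesis constrains edges whose second end avoids `r` and `s`; by symmetry this
-- reaches every edge but `rs`.
recognise : ∀ {m} (G : SignedGraph (3 + m)) (θ : Fin (3 + m) → Sign) {r s u} →
  Adj G r s → Adj G r u → Adj G s u → θ r · (σ G r s · θ s) ≡ neg →
  (∀ {v} → Adj G r v → v ≡ s ⊎ v ≡ u) → (∀ {v} → Adj G s v → v ≡ r ⊎ v ≡ u) →
  (∀ {v w} → v ≢ r → v ≢ s → w ≢ r → w ≢ s → v ≢ w → Adj G v w) →
  (∀ {v w} → w ≢ r → w ≢ s → Adj G v w → θ v · (σ G v w · θ w) ≡ pos) →
  SwitchingEquivalent G (C3⁻·K (3 + m))
recognise {m} G θ {r} {s} {u} rs ru su rs-neg only-r only-s complete positive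
  with relabel (Adj⇒≢ G rs) (Adj⇒≢ G ru) (Adj⇒≢ G su)
... | π , refl , refl , refl = π , θ , adj-eq , σ-eq
  where
  H = C3⁻·K (3 + m)
  f = Inverse.to π
  f-≢ : ∀ {i j} → i ≢ j → f i ≢ f j
  f-≢ i≢j = i≢j ∘ to-injective π
  missing-r : ∀ j → ¬ Adj G (f zero) (f (suc (suc (suc j))))
  missing-r j a with only-r a
  ... | inj₁ eq = contradiction (to-injective π eq) λ ()
  ... | inj₂ eq = contradiction (to-injective π eq) λ ()
  missing-s : ∀ j → ¬ Adj G (f (suc zero)) (f (suc (suc (suc j))))
  missing-s j a with only-s a
  ... | inj₁ eq = contradiction (to-injective π eq) λ ()
  ... | inj₂ eq = contradiction (to-injective π eq) λ ()
  flip : ∀ {i j b} → adj G (f i) (f j) ≡ b → adj G (f j) (f i) ≡ b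
  flip = trans (adj-sym G _ _)
  big-eq : ∀ i j → adj G (f (suc (suc i))) (f (suc (suc j))) ≡ adj H (suc (suc i)) (suc (suc j))
  big-eq i j with i ≟ᶠ j
  ... | yes refl = trans (loopless G _) (sym (loopless H (suc (suc i))))
  ... | no i≢j   = trans
    (T⇒≡true (complete (f-≢ λ ()) (f-≢ λ ()) (f-≢ λ ()) (f-≢ λ ()) (f-≢ λ { refl → i≢j refl })))
    (sym (T⇒≡true (extremal-clique i≢j)))
  adj-eq : ∀ i j → adj G (f i) (f j) ≡ adj H i j
  adj-eq zero                zero                = loopless G _
  adj-eq zero                (suc zero)          = T⇒≡true rs
  adj-eq zero                (suc (suc zero))    = T⇒≡true ru
  adj-eq zero                (suc (suc (suc j))) = ¬T⇒≡false (missing-r j)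
  adj-eq (suc zero)          zero                = flip (T⇒≡true rs)
  adj-eq (suc zero)          (suc zero)          = loopless G _
  adj-eq (suc zero)          (suc (suc zero))    = T⇒≡true su
  adj-eq (suc zero)          (suc (suc (suc j))) = ¬T⇒≡false (missing-s j)
  adj-eq (suc (suc zero))    zero                = flip (T⇒≡true ru)
  adj-eq (suc (suc (suc i))) zero                = flip (¬T⇒≡false (missing-r i))
  adj-eq (suc (suc zero))    (suc zero)          = flip (T⇒≡true su)
  adj-eq (suc (suc (suc i))) (suc zero)          = flip (¬T⇒≡false (missing-s i))
  adj-eq (suc (suc i))       (suc (suc j))       = big-eq i j
  reverse : ∀ {v w} → Adj G v w → θ v · (σ G v w · θ w) ≡ θ w · (σ G w v · θ v)
  reverse {v} {w} vw = trans (cong (λ t → θ v · (t · θ w)) (σ-sym G v w vw)) (conj-sym (θ v) _ (θ w))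
  σ-eq : ∀ i j → T (adj H i j) → θ (f i) · (σ G (f i) (f j) · θ (f j)) ≡ σ H i j
  σ-eq i j ij = go i j ij (subst T (sym (adj-eq i j)) ij)
    where
    go : ∀ i j → T (adj H i j) → Adj G (f i) (f j) → θ (f i) · (σ G (f i) (f j) · θ (f j)) ≡ σ H i j
    go zero          zero          () _
    go zero          (suc zero)    _ _  = rs-neg
    go zero          (suc (suc j)) _ ij = positive (f-≢ λ ()) (f-≢ λ ()) ij
    go (suc zero)    zero          _ ij = trans (reverse ij) rs-neg
    go (suc zero)    (suc zero)    () _
    go (suc zero)    (suc (suc j)) _ ij = positive (f-≢ λ ()) (f-≢ λ ()) ij
    go (suc (suc i)) zero          _ ij = trans (reverse ij) (positive (f-≢ λ ()) (f-≢ λ ()) (Adj-sym G ij))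
    go (suc (suc i)) (suc zero)    _ ij = trans (reverse ij) (positive (f-≢ λ ()) (f-≢ λ ()) (Adj-sym G ij))
    go (suc (suc i)) (suc (suc j)) _ ij = positive (f-≢ λ ()) (f-≢ λ ()) ij

-- Counting vertices and missing edges

-- Here |M₁| = 8 + d, y vertices lie outside M₂ and z in M₂ ∖ M₁; the ordered non-edges number A inside
-- M₁, B outside M₁ and X in each direction between the two.
count-forces : ∀ W A B X y z d → W ≡ A + B + 2 * X →
  8 + d ≤ A → y + z ≤ B → y * (7 + d) + z * 7 ≤ X → W + 12 ≤ 5 * ((8 + d) + (y + z)) → 2 ≤ y →
  y ≡ 2 × z ≡ 0 × A ≡ 8 + d × B ≡ y + z × W + 12 ≡ 5 * ((8 + d) + (y + z))
count-forces _ _ _ _ (suc (suc y)) z d refl A≥ B≥ X≥ W≤ (s≤s (s≤s z≤n))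
  with m≤n⇒∃[o]m+o≡n A≥ | m≤n⇒∃[o]m+o≡n B≥ | m≤n⇒∃[o]m+o≡n X≥
... | α , refl | β , refl | ξ , refl =
  cong (2 +_) y≡0 , z≡0 ,
  trans (cong (8 + d +_) α≡0) (+-identityʳ _) ,
  trans (cong (2 + y + z +_) β≡0) (+-identityʳ _) ,
  trans (excess y z d α β ξ) (trans (cong (5 * ((8 + d) + (2 + y + z)) +_) rest≡0) (+-identityʳ _))
  where
  -- Two outer vertices alone meet the bound exactly. A further one costs 10 + 2d too much, a vertex
  -- of M₂ ∖ M₁ costs 10, and α, β, ξ are the slacks of the three estimates; so all of these vanish.
  excess : ∀ y z d α β ξ →
    (8 + d + α) + (2 + y + z + β) + 2 * ((2 + y) * (7 + d) + z * 7 + ξ) + 12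
      ≡ 5 * ((8 + d) + (2 + y + z)) + (10 * y + (10 * z + (α + (β + (2 * ξ + 2 * (y * d))))))
  excess = solve-∀
  rest≡0 : 10 * y + (10 * z + (α + (β + (2 * ξ + 2 * (y * d))))) ≡ 0
  rest≡0 = n≤0⇒n≡0 (+-cancelˡ-≤ (5 * ((8 + d) + (2 + y + z))) _ 0
    (subst₂ _≤_ (excess y z d α β ξ) (sym (+-identityʳ _)) W≤))
  rest₁ = m+n≡0⇒n≡0 (10 * y) rest≡0
  rest₂ = m+n≡0⇒n≡0 (10 * z) rest₁
  rest₃ = m+n≡0⇒n≡0 α rest₂
  y≡0 : y ≡ 0
  y≡0 = m+n≡0⇒m≡0 y (m+n≡0⇒m≡0 (10 * y) rest≡0)
  z≡0 : z ≡ 0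
  z≡0 = m+n≡0⇒m≡0 z (m+n≡0⇒m≡0 (10 * z) rest₁)
  α≡0 : α ≡ 0
  α≡0 = m+n≡0⇒m≡0 α rest₂
  β≡0 : β ≡ 0
  β≡0 = m+n≡0⇒m≡0 β rest₃

-- Two vertices outside M₁: the extremal graph or balance

module Extremal {m : ℕ} (G : SignedGraph (3 + m)) (k t : ℕ) (2k≡6+t : k + k ≡ 6 + t)
                (free : NegOddCycleFree G k) where

  open Switching G k t 2k≡6+t free
  private
    V = Fin (3 + m)
    Edge = Adj G

  -- The sign at `r` affects no edge except `rs`, so it can be chosen to make that edge positive.
  balanced-pendant : ∀ θ {r s} → PositiveOn θ (_≢ r) → (∀ {v} → Edge r v → v ≡ s) → Balanced G
  balanced-pendant θ {r} {s} θ-pos pendant = ψ , positive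
    where
    ψ : V → Sign
    ψ v with v ≟ᶠ r
    ... | yes _ = σ G r s · θ s
    ... | no  _ = θ v
    ψ-r : ψ r ≡ σ G r s · θ s
    ψ-r with r ≟ᶠ r
    ... | yes _   = refl
    ... | no r≢r = contradiction refl r≢r
    ψ-other : ∀ {v} → v ≢ r → ψ v ≡ θ v
    ψ-other {v} v≢r with v ≟ᶠ r
    ... | yes v≡r = contradiction v≡r v≢r
    ... | no _    = refl
    at-r : ∀ {v} → Edge r v → twist ψ r v ≡ pos
    at-r {v} rv with pendant rv
    ... | refl = trans
      (cong₂ (λ a b → a · (σ G r s · b)) ψ-r (ψ-other (Adj⇒≢ G rv ∘ sym)))
      (·-self (σ G r s · θ s))
    positive : ∀ v w → Edge v w → twist ψ v w ≡ pos
    positive v w vw = by-cases (v ≟ᶠ r) (w ≟ᶠ r)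
      where
      by-cases : Dec (v ≡ r) → Dec (w ≡ r) → twist ψ v w ≡ pos
      by-cases (yes refl) _          = at-r vw
      by-cases (no _)     (yes refl) = trans (twist-sym ψ vw) (at-r (Adj-sym G vw))
      by-cases (no v≢r)   (no w≢r)   =
        trans (cong₂ (λ a b → a · (σ G v w · b)) (ψ-other v≢r) (ψ-other w≢r)) (θ-pos v≢r w≢r vw)

  module TwoOutside (unbalanced : Unbalanced G) (θ : V → Sign) {M : V → Set} (M? : Decidable M)
    (attach : ∀ {v b} → M b → Edge v b → twist θ v b ≡ pos)
    (cross : ∀ {v w a b} → ¬ M v → ¬ M w → Edge v w → M a → M b → a ≢ b → Edge v a → Edge w b →
             twist θ v w ≡ pos)
    {r s : V} (rs : Edge r s) (r∉ : ¬ M r) (s∉ : ¬ M s) (r-few : ¬ Two G M r) (s-few : ¬ Two G M s)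
    (rest : ∀ {v} → v ≢ r → v ≢ s → M v)
    (complete : ∀ {v w} → M v → M w → v ≢ w → Edge v w) where

    unique-neighbour : ∀ {v a b} → ¬ Two G M v → M a → Edge v a → M b → Edge v b → b ≡ a
    unique-neighbour {v} {a} {b} v∉ Ma va Mb vb with b ≟ᶠ a
    ... | yes b≡a = b≡a
    ... | no b≢a  = contradiction (b , a , b≢a , (Mb , vb) , (Ma , va)) v∉

    pos-off : ∀ {r s} → (∀ {v} → v ≢ r → v ≢ s → M v) → PositiveOn θ (_≢ r)
    pos-off {r} {s} rest {v} {w} v≢r w≢r vw = by-cases (v ≟ᶠ s) (w ≟ᶠ s)
      where
      by-cases : Dec (v ≡ s) → Dec (w ≡ s) → twist θ v w ≡ pos
      by-cases _          (no w≢s)   = attach (rest w≢r w≢s) vw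
      by-cases (no v≢s)   (yes _)    = trans (twist-sym θ vw) (attach (rest v≢r v≢s) (Adj-sym G vw))
      by-cases (yes refl) (yes refl) = contradiction refl (Adj⇒≢ G vw)

    -- Without such a neighbour `r` would hang on `s` alone and the graph would be balanced. Here
    -- `r` and `s` are bound afresh so that their roles can be exchanged.
    has-neighbour : ∀ {r s} → (∀ {v} → v ≢ r → v ≢ s → M v) → ∃ λ a → M a × Edge r a
    has-neighbour {r} {s} rest with any? (λ a → M? a ×-dec Adj? G r a)
    ... | yes found = found
    ... | no ∄      = contradiction (balanced-pendant θ {r} {s} (pos-off rest) pendant) unbalanced
      where
      pendant : ∀ {v} → Edge r v → v ≡ s
      pendant {v} rv with v ≟ᶠ s
      ... | yes v≡s = v≡s
      ... | no v≢s  = contradiction (v , rest (Adj⇒≢ G rv ∘ sym) v≢s , rv) ∄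

    -- This is the only edge without an end in `M`, hence the only one that can prevent balance.
    rs-neg : twist θ r s ≡ neg
    rs-neg = ¬pos⇒neg λ rs-pos → unbalanced (θ , positive rs-pos)
      where
      positive : twist θ r s ≡ pos → ∀ v w → Edge v w → twist θ v w ≡ pos
      positive rs-pos v w vw = by-cases (v ≟ᶠ r) (w ≟ᶠ r) (w ≟ᶠ s)
        where
        by-cases : Dec (v ≡ r) → Dec (w ≡ r) → Dec (w ≡ s) → twist θ v w ≡ pos
        by-cases (no v≢r)   (no w≢r)   _          = pos-off rest v≢r w≢r vw
        by-cases (yes refl) _          (yes refl) = rs-pos
        by-cases (yes refl) _          (no w≢s)   = attach (rest (Adj⇒≢ G vw ∘ sym) w≢s) vw
        by-cases (no v≢r)   (yes refl) _          with v ≟ᶠ s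
        ... | yes refl = trans (twist-sym θ vw) rs-pos
        ... | no v≢s   = trans (twist-sym θ vw) (attach (rest v≢r v≢s) (Adj-sym G vw))

    rest′ : ∀ {v} → v ≢ s → v ≢ r → M v
    rest′ v≢s v≢r = rest v≢r v≢s

    -- Distinct neighbours of `r` and `s` in `M` would make `rs` positive by `cross`; a common one
    -- completes the negative triangle.
    equivalent : SwitchingEquivalent G (C3⁻·K (3 + m))
    equivalent with has-neighbour rest | has-neighbour rest′
    ... | a , Ma , ra | b , Mb , sb with a ≟ᶠ b
    ...   | no a≢b = contradiction
      (trans (sym rs-neg) (cross r∉ s∉ rs Ma Mb a≢b ra sb)) λ ()
    ...   | yes refl = recognise G θ rs ra sb rs-neg (only rest r-few Ma ra) (only rest′ s-few Ma sb)
      (λ v≢r v≢s w≢r w≢s → complete (rest v≢r v≢s) (rest w≢r w≢s))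
      (λ w≢r w≢s → attach (rest w≢r w≢s))
      where
      only : ∀ {r s a} → (∀ {v} → v ≢ r → v ≢ s → M v) → ¬ Two G M r → M a → Edge r a →
        ∀ {v} → Edge r v → v ≡ s ⊎ v ≡ a
      only {s = s} rest r∉ Ma ra {v} rv with v ≟ᶠ s
      ... | yes v≡s = inj₁ v≡s
      ... | no v≢s  = inj₂ (unique-neighbour r∉ Ma ra (rest (Adj⇒≢ G rv ∘ sym) v≢s) rv)

-- Enlarging the clique to M₁ and M₂

module LargeClique {m : ℕ} (G : SignedGraph (3 + m)) (k t : ℕ) (2k≡6+t : k + k ≡ 6 + t)
                   (free : NegOddCycleFree G k)
                   (x₀ p q z : Fin (3 + m)) (C₀ : List (Fin (3 + m)))
                   (C-clique : AllPairs (Adj G) (x₀ ∷ p ∷ q ∷ z ∷ C₀))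
                   (8+t≤∣C∣ : 8 + t ≤ length (x₀ ∷ p ∷ q ∷ z ∷ C₀)) where

  open Switching G k t 2k≡6+t free
  open Extremal G k t 2k≡6+t free
  private
    n = 3 + m
    V = Fin n
    Edge = Adj G
    C : List V
    C = x₀ ∷ p ∷ q ∷ z ∷ C₀
    module CS = CliqueSigns G k t 2k≡6+t free x₀ p q z C₀ C-clique 8+t≤∣C∣
  open Clique G C C-clique using (C!; clique-two)
  open DecMembership (_≟ᶠ_ {n}) using (_∈?_)

  K M₁ M₂ : V → Set
  K  = _∈ C
  M₁ = Two G K
  M₂ = Two G M₁

  K? : Decidable K
  K? v = v ∈? C
  M₁? : Decidable M₁
  M₁? = Two? G K?
  M₂? : Decidable M₂
  M₂? = Two? G M₁?

  K⊆M₁ : ∀ {v} → K v → M₁ v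
  K⊆M₁ = clique-two (s≤s (s≤s (s≤s z≤n)))
  M₁⊆M₂ : ∀ {v} → M₁ v → M₂ v
  M₁⊆M₂ = Two-mono G K⊆M₁
  M₂-two : ∀ {v} → M₂ v → Two G M₂ v
  M₂-two = Two-mono G M₁⊆M₂

  -- Paths with 2k - 4 up to 2k vertices: two enlargements with up to two new ends each consume this
  -- range of five lengths.
  K-linked : ∀ i → i ≤ 4 → Linked K (2 + (i + t))
  K-linked i i≤4 = CS.clique-linked (i + t)
    (≤-trans (+-monoʳ-≤ 2 (+-monoˡ-≤ t i≤4)) (≤-trans (m≤n+m _ 2) 8+t≤∣C∣))

  M₁-linked : ∀ i → i ≤ 2 → Linked M₁ (4 + (i + t))
  M₁-linked i i≤2 = Two-linked K? K⊆M₁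
    (K-linked i (≤-trans i≤2 (s≤s (s≤s z≤n))))
    (K-linked (1 + i) (≤-trans (s≤s i≤2) (s≤s (s≤s (s≤s z≤n)))))
    (K-linked (2 + i) (s≤s (s≤s i≤2)))

  M₂-linked : Linked M₂ (6 + t)
  M₂-linked = Two-linked M₁? M₁⊆M₂ (M₁-linked 0 z≤n) (M₁-linked 1 (s≤s z≤n)) (M₁-linked 2 ≤-refl)

  private
    -- Three successive switchings: `E₁` makes M₁ positive, `E₂` all edges with an end in M₁ and all
    -- of M₂, `E₃` all edges with an end in M₂.
    module E₁ = Extension CS.θ₀ K? CS.clique-pos K⊆M₁
    M₁-pos : PositiveOn E₁.θ′ M₁
    M₁-pos = E₁.Two-pos (K-linked 4 ≤-refl) (K-linked 3 (s≤s (s≤s (s≤s z≤n))))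
    module E₂ = Extension E₁.θ′ M₁? M₁-pos M₁⊆M₂
    M₂-pos : PositiveOn E₂.θ′ M₂
    M₂-pos = E₂.Two-pos (M₁-linked 2 ≤-refl) (M₁-linked 1 (s≤s z≤n))
    module E₃ = Extension E₂.θ′ M₂? M₂-pos M₂-two

  attach₁ : ∀ {v b} → M₁ b → Edge v b → twist E₂.θ′ v b ≡ pos
  attach₁ = E₂.attach (M₁-linked 2 ≤-refl)

  -- With at most one vertex outside M₂, every edge has an end in M₂.
  balanced-if-cover : (∀ {v w} → ¬ M₂ v → ¬ M₂ w → v ≢ w → ⊥) → Balanced G
  balanced-if-cover cover = E₃.θ′ , positive
    where
    positive : ∀ v w → Edge v w → twist E₃.θ′ v w ≡ pos
    positive v w vw = by-cases (M₂? v) (M₂? w)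
      where
      by-cases : Dec (M₂ v) → Dec (M₂ w) → twist E₃.θ′ v w ≡ pos
      by-cases _        (yes w∈) = E₃.attach M₂-linked w∈ vw
      by-cases (yes v∈) (no _)   =
        trans (twist-sym E₃.θ′ vw) (E₃.attach M₂-linked v∈ (Adj-sym G vw))
      by-cases (no v∉)  (no w∉)  = ⊥-elim (cover v∉ w∉ (Adj⇒≢ G vw))

  private
    Y O Oy Oz : List V
    Y  = filter M₁? (allFin n)
    O  = filter (¬? ∘ M₁?) (allFin n)
    Oz = filter M₂? O
    Oy = filter (¬? ∘ M₂?) O

    Y! : Unique Y
    Y! = Unique.filter⁺ M₁? (Unique.allFin⁺ n)
    ∈Y⇒M₁ : ∀ {v} → v ∈ Y → M₁ v
    ∈Y⇒M₁ v∈ = proj₂ (∈-filter⁻ M₁? {xs = allFin n} v∈)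
    M₁⇒∈Y : ∀ {v} → M₁ v → v ∈ Y
    M₁⇒∈Y = ∈-filter⁺ M₁? (∈-allFin _)
    ∉M₁⇒∈O : ∀ {v} → ¬ M₁ v → v ∈ O
    ∉M₁⇒∈O = ∈-filter⁺ (¬? ∘ M₁?) (∈-allFin _)
    ∈O⇒∉M₁ : ∀ {v} → v ∈ O → ¬ M₁ v
    ∈O⇒∉M₁ v∈ = proj₂ (∈-filter⁻ (¬? ∘ M₁?) {xs = allFin n} v∈)
    ∈Oy⇒∉M₂ : ∀ {v} → v ∈ Oy → ¬ M₂ v
    ∈Oy⇒∉M₂ v∈ = proj₂ (∈-filter⁻ (¬? ∘ M₂?) {xs = O} v∈)
    ∉M₂⇒∈Oy : ∀ {v} → ¬ M₂ v → v ∈ Oy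
    ∉M₂⇒∈Oy v∉ = ∈-filter⁺ (¬? ∘ M₂?) (∉M₁⇒∈O (v∉ ∘ M₁⊆M₂)) v∉

    C⊆Y : C ⊆ Y
    C⊆Y = M₁⇒∈Y ∘ K⊆M₁
    8≤∣C∣ : 8 ≤ length C
    8≤∣C∣ = ≤-trans (m≤m+n 8 t) 8+t≤∣C∣
    8≤∣Y∣ : 8 ≤ length Y
    8≤∣Y∣ = ≤-trans 8≤∣C∣ (length-⊆ C! C⊆Y)

    ∣O∣≡ : length O ≡ length Oy + length Oz
    ∣O∣≡ = trans (length-split M₂? O) (+-comm (length Oz) _)

    n≡ : ∀ {d} → 8 + d ≡ length Y → n ≡ (8 + d) + (length Oy + length Oz)
    n≡ 8+d≡ = trans (sym (length-tabulate {n = n} id))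
      (trans (length-split M₁? (allFin n)) (cong₂ _+_ (sym 8+d≡) ∣O∣≡))

    cross-bound : ∀ {d} → 8 + d ≡ length Y →
      length Oy * (7 + d) + length Oz * 7 ≤ ∑ O (nonDegree G Y)
    cross-bound {d} 8+d≡ = begin
      length Oy * (7 + d) + length Oz * 7
        ≡⟨ cong₂ _+_ (∑-const Oy (7 + d)) (∑-const Oz 7) ⟨
      ∑ Oy (λ _ → 7 + d) + ∑ Oz (λ _ → 7)
        ≤⟨ +-mono-≤ (∑-mono Oy far) (∑-mono Oz near) ⟩
      ∑ Oy (nonDegree G Y) + ∑ Oz (nonDegree G Y)
        ≡⟨ +-comm (∑ Oy (nonDegree G Y)) _ ⟩
      ∑ Oz (nonDegree G Y) + ∑ Oy (nonDegree G Y)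
        ≡⟨ ∑-split M₂? O (nonDegree G Y) ⟨
      ∑ O (nonDegree G Y) ∎
      where
      open ≤-Reasoning
      -- A vertex outside M₂ misses all but at most one of the 8 + d vertices of M₁; in `near`, a
      -- vertex outside M₁ misses all but at most one of the at least 8 vertices of `C`.
      far : ∀ {v} → v ∈ Oy → 7 + d ≤ nonDegree G Y v
      far {v} v∈ = ≤-pred (subst (_≤ 1 + nonDegree G Y v) (sym 8+d≡)
        (¬Two⇒nonDegree G Y Y! ∈Y⇒M₁ (∈Oy⇒∉M₂ v∈)))
      near : ∀ {v} → v ∈ Oz → 7 ≤ nonDegree G Y v
      near {v} v∈ = ≤-trans
        (≤-pred (≤-trans 8≤∣C∣
          (¬Two⇒nonDegree G C C! id (∈O⇒∉M₁ (proj₁ (∈-filter⁻ M₂? {xs = O} v∈))))))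
        (∑-⊆ (non G v) C! C⊆Y)

  Oy≡O : length Oz ≡ 0 → Oy ≡ O
  Oy≡O z≡0 = filter-complete (¬? ∘ M₂?)
    (sym (trans ∣O∣≡ (trans (cong (length Oy +_) z≡0) (+-identityʳ _))))

  sparse⇒tight : Unbalanced G → nonEdges G (allFin n) + 12 ≤ 5 * n →
    nonEdges G (allFin n) + 12 ≡ 5 * n × SwitchingEquivalent G (C3⁻·K n)
  sparse⇒tight unbalanced sparse = by-size (2 ≤? length Oy)
    where
    W = nonEdges G (allFin n)
    -- The list is a variable so that length 2 can be matched; it will be `Oy`, which equals `O`
    -- once `Oz` is empty.
    conclude : ∀ o → length o ≡ 2 → Unique o → (∀ {v} → ¬ M₁ v → v ∈ o) → (∀ {v} → v ∈ o → ¬ M₂ v) →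
      nonEdges G o ≤ length o → nonEdges G Y ≤ length Y → SwitchingEquivalent G (C3⁻·K n)
    conclude (r ∷ s ∷ []) refl ((r≢s ∷ _) ∷ _) out⊆ ∉M₂ tight Y-tight =
      TwoOutside.equivalent unbalanced E₂.θ′ M₁? attach₁
        (E₂.cross (M₁-linked 2 ≤-refl) (M₁-linked 1 (s≤s z≤n)))
        (nonEdges≤length⇒complete G (r ∷ s ∷ []) tight (here refl) (there (here refl)) r≢s)
        (r∉ ∘ M₁⊆M₂) (s∉ ∘ M₁⊆M₂) r∉ s∉ rest
        (λ v∈ w∈ → nonEdges≤length⇒complete G Y Y-tight (M₁⇒∈Y v∈) (M₁⇒∈Y w∈))
      where
      r∉ : ¬ M₂ r
      r∉ = ∉M₂ (here refl)
      s∉ : ¬ M₂ s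
      s∉ = ∉M₂ (there (here refl))
      rest : ∀ {v} → v ≢ r → v ≢ s → M₁ v
      rest {v} v≢r v≢s with M₁? v
      ... | yes v∈ = v∈
      ... | no v∉ with out⊆ v∉
      ...   | here v≡r         = contradiction v≡r v≢r
      ...   | there (here v≡s) = contradiction v≡s v≢s
    Oy! : Unique Oy
    Oy! = Unique.filter⁺ (¬? ∘ M₂?) (Unique.filter⁺ (¬? ∘ M₁?) (Unique.allFin⁺ n))
    extremal : ∀ d → 8 + d ≡ length Y →
      length Oy ≡ 2 × length Oz ≡ 0 × nonEdges G Y ≡ 8 + d × nonEdges G O ≡ length Oy + length Oz ×
        W + 12 ≡ 5 * ((8 + d) + (length Oy + length Oz)) →
      W + 12 ≡ 5 * n × SwitchingEquivalent G (C3⁻·K n)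
    extremal d 8+d≡ (y≡2 , z≡0 , A≡ , B≡ , W≡) =
      trans W≡ (cong (5 *_) (sym (n≡ 8+d≡))) ,
      conclude Oy y≡2 Oy! (λ v∉ → subst (_ ∈_) (sym (Oy≡O z≡0)) (∉M₁⇒∈O v∉)) ∈Oy⇒∉M₂
        (≤-reflexive (subst (λ o → nonEdges G o ≡ length o) (sym (Oy≡O z≡0)) (trans B≡ (sym ∣O∣≡))))
        (≤-reflexive (trans A≡ 8+d≡))
    by-size : Dec (2 ≤ length Oy) → W + 12 ≡ 5 * n × SwitchingEquivalent G (C3⁻·K n)
    by-size (no ∣Oy∣<2) = contradiction (balanced-if-cover λ {v} {w} v∉ w∉ v≢w →
      ∣Oy∣<2 (length-⊆ ((v≢w ∷ []) ∷ [] ∷ [])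
        λ { (here refl) → ∉M₂⇒∈Oy v∉ ; (there (here refl)) → ∉M₂⇒∈Oy w∉ })) unbalanced
    by-size (yes 2≤∣Oy∣) =
      let d , 8+d≡ = m≤n⇒∃[o]m+o≡n 8≤∣Y∣ in
      extremal d 8+d≡ (count-forces W (nonEdges G Y) (nonEdges G O) (∑ O (nonDegree G Y))
        (length Oy) (length Oz) d
        (nonEdges-split G M₁? (allFin n))
        (subst (_≤ nonEdges G Y) (sym 8+d≡) (length≤nonEdges G Y))
        (subst (_≤ nonEdges G O) ∣O∣≡ (length≤nonEdges G O))
        (cross-bound 8+d≡)
        (subst (λ l → W + 12 ≤ 5 * l) (n≡ 8+d≡) sparse) 2≤∣Oy∣)

-- The large clique in a graph with few non-edges

sparse⇒extremal : ∀ {m} j (G : SignedGraph (3 + m)) → Unbalanced G → 10 * (3 + j + 1) ≤ 3 + m →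
  NegOddCycleFree G (3 + j) → nonEdges G (allFin (3 + m)) + 12 ≤ 5 * (3 + m) →
  nonEdges G (allFin (3 + m)) + 12 ≡ 5 * (3 + m) × SwitchingEquivalent G (C3⁻·K (3 + m))
sparse⇒extremal {m} j G unbalanced 10k≤n free sparse =
  let C , C-clique , _ , bound = turán G (length (allFin n)) (allFin n) ≤-refl in
  from-clique C C-clique (large C (subst (λ l → 10 * l ≤ 25 * length C + W) (length-tabulate {n = n} id) bound))
  where
  open ≤-Reasoning
  n = 3 + m
  W = nonEdges G (allFin n)
  double : ∀ j → (3 + j) + (3 + j) ≡ 6 + (j + j)
  double = solve-∀
  scale : ∀ j → 25 * (8 + (j + j)) ≡ 5 * (10 * (3 + j + 1))
  scale = solve-∀
  split-ten : ∀ n → 10 * n ≡ 5 * n + 5 * n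
  split-ten = solve-∀
  -- Non-edges use up at most half of 10n, so 25|C| ≥ 5n ≥ 50(k + 1).
  large : ∀ C → 10 * n ≤ 25 * length C + W → 8 + (j + j) ≤ length C
  large C bound = *-cancelˡ-≤ 25 (+-cancelʳ-≤ W _ _ (begin
    25 * (8 + (j + j)) + W     ≡⟨ cong (_+ W) (scale j) ⟩
    5 * (10 * (3 + j + 1)) + W ≤⟨ +-mono-≤ (*-monoʳ-≤ 5 10k≤n) (≤-trans (m≤m+n W 12) sparse) ⟩
    5 * n + 5 * n              ≡⟨ split-ten n ⟨
    10 * n                     ≤⟨ bound ⟩
    25 * length C + W          ∎))
  from-clique : ∀ C → AllPairs (Adj G) C → 8 + (j + j) ≤ length C →
    W + 12 ≡ 5 * n × SwitchingEquivalent G (C3⁻·K n)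
  from-clique []               _ ()
  from-clique (_ ∷ [])         _ (s≤s ())
  from-clique (_ ∷ _ ∷ [])     _ (s≤s (s≤s ()))
  from-clique (_ ∷ _ ∷ _ ∷ []) _ (s≤s (s≤s (s≤s ())))
  from-clique (x ∷ p ∷ q ∷ z ∷ C) C-clique 8+t≤∣C∣ =
    LargeClique.sparse⇒tight G (3 + j) (j + j) (double j) free x p q z C C-clique 8+t≤∣C∣ unbalanced sparse

-- From non-edges back to the edge bound

module _ {m : ℕ} (G : SignedGraph (3 + m)) where

  private
    n = 3 + m
    W = nonEdges G (allFin n)

    handshake′ : 2 * e G + W ≡ n * (2 + m) + n
    handshake′ = trans (handshake G) (expand m)
      where
      expand : ∀ m → (3 + m) * (3 + m) ≡ (3 + m) * (2 + m) + (3 + m)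
      expand = solve-∀

    collect : ∀ m → 4 * m + (3 + m) + 12 ≡ 5 * (3 + m)
    collect = solve-∀


  many-edges⇒sparse : n * (2 + m) ≤ 2 * e G + 4 * m → W + 12 ≤ 5 * n
  many-edges⇒sparse many = subst (W + 12 ≤_) (collect m) (+-monoˡ-≤ 12 (+-cancelˡ-≤ (2 * e G) _ _ (begin
    2 * e G + W             ≡⟨ handshake′ ⟩
    n * (2 + m) + n         ≤⟨ +-monoˡ-≤ n many ⟩
    2 * e G + 4 * m + n     ≡⟨ +-assoc (2 * e G) (4 * m) n ⟩
    2 * e G + (4 * m + n)   ∎)))
    where open ≤-Reasoning

  tight-nonEdges⇒tight-edges : W + 12 ≡ 5 * n → 2 * e G + 4 * m ≡ n * (2 + m)
  tight-nonEdges⇒tight-edges tight = +-cancelʳ-≡ n _ _ (begin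
    2 * e G + 4 * m + n     ≡⟨ +-assoc (2 * e G) (4 * m) n ⟩
    2 * e G + (4 * m + n)   ≡⟨ cong (2 * e G +_) (+-cancelʳ-≡ 12 _ _ (trans tight (sym (collect m)))) ⟨
    2 * e G + W             ≡⟨ handshake′ ⟩
    n * (2 + m) + n         ∎)
    where open ≡-Reasoning

theorem1p3 : (n k : ℕ) (G : SignedGraph n) →
    Unbalanced G → 3 ≤ k → 10 * (k + 1) ≤ n → NegOddCycleFree G k →
    (2 * e G + 4 * (n ∸ 3) ≤ n * (n ∸ 1)) ×
    ((2 * e G + 4 * (n ∸ 3) ≡ n * (n ∸ 1)) ⇔ SwitchingEquivalent G (C3⁻·K n))
theorem1p3 n k G unbalanced 3≤k 10k≤n free
  with m≤n⇒∃[o]m+o≡n 3≤k | m≤n⇒∃[o]m+o≡n (≤-trans 3≤k (≤-trans (m≤m+n k 1) (≤-trans (m≤n*m (k + 1) 10) 10k≤n)))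
... | j , refl | m , refl = bound , mk⇔ (proj₂ ∘ extremal ∘ ≤-reflexive ∘ sym) equal
  where
  -- Reaching the bound already forces equality and the extremal structure, so the inequality and
  -- one direction of the equivalence share this argument.
  extremal : (3 + m) * (2 + m) ≤ 2 * e G + 4 * m →
    nonEdges G (allFin (3 + m)) + 12 ≡ 5 * (3 + m) × SwitchingEquivalent G (C3⁻·K (3 + m))
  extremal many = sparse⇒extremal j G unbalanced 10k≤n free (many-edges⇒sparse G many)
  bound : 2 * e G + 4 * m ≤ (3 + m) * (2 + m)
  bound with ≤-total (2 * e G + 4 * m) ((3 + m) * (2 + m))
  ... | inj₁ few  = few
  ... | inj₂ many = ≤-reflexive (tight-nonEdges⇒tight-edges G (proj₁ (extremal many)))
  equal : SwitchingEquivalent G (C3⁻·K (3 + m)) → 2 * e G + 4 * m ≡ (3 + m) * (2 + m)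
  equal equiv = tight-nonEdges⇒tight-edges G
    (trans (cong (_+ 12) (SwitchingEquivalent⇒nonEdges≡ {G = G} {H = C3⁻·K (3 + m)} equiv)) (extremal-nonEdges m))
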